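{- Let $G_0$ be a connected graph with edges $e_0,e_1$, and let $G_n$ ($n\ge 1$) be the ladder $GL_n$ or the cross $GC_n$ constructed from $G_0,e_0,e_1$. Suppose that $f_{G_n}(x)=f_{G_0}(x)\,f_{{\cal S}_j^n}(x)$ for $j=1$ or $j=6$. If $f_{G_0}(x)$ is log-concave (respectively, unimodal), then $f_{G_n}(x)$ is log-concave (respectively, unimodal).
   Context: For a graph $G$ let $g_i(G)$ be the number of 2-cell embeddings of $G$ on the orientable surface of genus $i$ (embeddings counted as rotation systems), let $\gamma,\gamma_M$ be the minimum and maximum genus of $G$, and let $f_G(x)=\sum_{i=\gamma}^{\gamma_M}g_i(G)x^i$ be its genus polynomial. Ladders and crosses: given edges $e_0,e_1$ of a connected graph $G_0$, add (subdividing) vertices $u_1,\dots,u_n$ in sequence on $e_0$ and $v_1,\dots,v_n$ in sequence on $e_1$. Adding the edges $u_lv_l$, $1\le l\le n$ (parallel rungs), gives the ladder $GL_n$; adding instead the edges $u_lv_{n-l+1}$, $1\le l\le n$, gives the cross $GC_n$. Ladder surfaces: a surface is represented by a cyclic word in which every occurring letter $x$ appears exactly once as $x$ and exactly once as $x^-$; it is the closed orientable surface obtained from a polygon with boundary labelled by the word by identifying each side $x$ with the side $x^-$ (orientation reversed). Let $a,a_1,a_2,\dots$ be distinct letters. For subsets $K,T\subseteq\{1,\dots,n\}$ put: $R_1^n$ = product of the $a_k$, $k\in K$, in decreasing order of index; $R_2^n$ = product of the $a_k$, $k\notin K$, in increasing order; $R_3^n$ = product of the $a_t^-$, $t\in T$,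 in decreasing order; $R_4^n$ = product of the $a_t^-$, $t\notin T$, in increasing order. Let ${\cal S}_1^n=\{R_1^nR_2^nR_3^nR_4^n\}$ and ${\cal S}_6^n=\{aR_1^nR_4^na^-R_2^nR_3^n\}$, with $(K,T)$ running over all $4^n$ pairs of subsets, counted with multiplicity. $f_{{\cal S}_j^n}(x)=\sum_i g_{i_j}(n)x^i$, where $g_{i_j}(n)$ is the number of surfaces of genus $i$ in ${\cal S}_j^n$. A polynomial is log-concave (unimodal) if its coefficient sequence is. A finite sequence of nonnegative numbers is log-concave if $a_i^2\ge a_{i-1}a_{i+1}$ for all interior $i$, and unimodal if it is weakly increasing up to a maximal value and weakly decreasing afterwards. -}

module Defs where

open import Data.Fin using (Fin; zero; suc; inject₁; fromℕ; opposite; splitAt; _↑ˡ_; _↑ʳ_)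
open import Data.Fin.Subset using (Subset; inside; outside; ∁)
open import Data.Fin.Subset.Properties using (_∈?_)
open import Data.List using (List; []; _∷_; [_]; _++_; map; filter; reverse; length; upTo; allFin; iterate; deduplicate; cartesianProduct; cartesianProductWith)
open import Data.List.Relation.Unary.All using (All; all?)
open import Data.Maybe using (Maybe; just; nothing)
open import Data.Nat using (ℕ; zero; suc; _+_; _*_; _∸_; _≤_; _<_; ⌊_/2⌋)
open import Data.Nat.ListAction using (sum)
open import Data.Product using (∃-syntax; _×_; _,_; uncurry)
open import Data.Sign using (Sign)
open import Data.Sum using ([_,_]′)
open import Data.Vec using (Vec; lookup) renaming ([] to []ᵛ; _∷_ to _∷ᵛ_)
open import Relation.Binary.Construct.Closure.Equivalence using (EqClosure)
open import Relation.Binary.Definitions using (DecidableEquality)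
open import Relation.Binary.PropositionalEquality using (_≡_)
open import Relation.Nullary using (Dec; yes; no)
open import Relation.Nullary.Decidable using (_×-dec_; _→-dec_)
import Data.Fin.Properties as Fin
import Data.List.Membership.DecPropositional as DecMembership
import Data.Maybe.Properties as Maybe
import Data.Nat.Properties as ℕ
import Data.Product.Properties as Product
import Data.Sign.Properties as Sign

------------------------------------------------------------------------
-- Polynomials

-- The genus polynomials are given by their coefficients, extended by zero
-- outside the range of exponents that occur.  The extension affects
-- neither log-concavity nor unimodality.
Poly : Set
Poly = ℕ → ℕ

infixl 7 _⊛_

_⊛_ : Poly → Poly → Poly
(p ⊛ q) k = sum (map (λ i → p i * q (k ∸ i)) (upTo (suc k)))

LogConcave : Poly → Set
LogConcave a = ∀ i → a i * a (2 + i) ≤ a (1 + i) * a (1 + i)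

Unimodal : Poly → Set
Unimodal a = ∃[ m ] (∀ i → i < m → a i ≤ a (suc i)) × (∀ i → m ≤ i → a (suc i) ≤ a i)

------------------------------------------------------------------------
-- Enumerations and orbits

allVecs : {A : Set} → List A → ∀ n → List (Vec A n)
allVecs xs zero    = [ []ᵛ ]
allVecs xs (suc n) = cartesianProductWith _∷ᵛ_ xs (allVecs xs n)

module _ {A : Set} (_≟_ : DecidableEquality A) where

  open DecMembership _≟_ using (_∈_) renaming (_∈?_ to _∈ˡ?_)

  -- For a permutation f of the elements of xs: y lies in the orbit of x iff
  -- it is one of x, f x, …, f ^ (length xs ∸ 1) x.
  InOrbit : (A → A) → List A → A → A → Set
  InOrbit f xs x y = y ∈ iterate f x (length xs)

  inOrbit? : ∀ f xs x y → Dec (InOrbit f xs x y)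
  inOrbit? f xs x y = y ∈ˡ? iterate f x (length xs)

  orbitCount : (A → A) → List A → ℕ
  orbitCount f xs = length (deduplicate (inOrbit? f xs) xs)

------------------------------------------------------------------------
-- Graphs and their embeddings

-- Finite graphs, with loops and multiple edges allowed.  The order in which
-- the two ends of an edge are listed is only a device for naming them.
record Graph : Set where
  field
    order size : ℕ
    end        : Fin size → Fin 2 → Fin order

  Vertex Edge : Set
  Vertex = Fin order
  Edge   = Fin size

  -- A dart (half-edge) is an edge together with one of its two ends.
  Dart : Set
  Dart = Edge × Fin 2

  base : Dart → Vertex
  base = uncurry end

  flip : Dart → Dart
  flip (e , s) = e , opposite s

  darts : List Dart
  darts = cartesianProduct (allFin size) (allFin 2)

  _≟ᵈ_ : DecidableEquality Dart
  _≟ᵈ_ = Product.≡-dec Fin._≟_ Fin._≟_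

  Adjacent : Vertex → Vertex → Set
  Adjacent u v = ∃[ e ] end e zero ≡ u × end e (suc zero) ≡ v

  Connected : Set
  Connected = ∀ u v → EqClosure Adjacent u v

  -- The table of a map from darts to darts.
  Table : Set
  Table = Vec (Vec Dart 2) size

  tables : List Table
  tables = allVecs (allVecs darts 2) size

  apply : Table → Dart → Dart
  apply ρ (e , s) = lookup (lookup ρ e) s

  -- A rotation system permutes the darts at each vertex in a single cycle:
  -- every dart is sent to a dart at the same vertex, and all darts at a
  -- vertex are reached from any one of them.
  IsRotation : Table → Set
  IsRotation ρ =
      All (λ d → base (apply ρ d) ≡ base d) darts
    × All (λ d → All (λ d′ → base d ≡ base d′ → InOrbit _≟ᵈ_ (apply ρ) darts d d′) darts) darts

  isRotation? : ∀ ρ → Dec (IsRotation ρ)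
  isRotation? ρ =
          all? (λ d → base (apply ρ d) Fin.≟ base d) darts
    ×-dec all? (λ d → all? (λ d′ → (base d Fin.≟ base d′) →-dec inOrbit? _≟ᵈ_ (apply ρ) darts d d′) darts) darts

  -- Face tracing: traverse an edge, then turn to the next dart in the
  -- rotation at the vertex reached.
  faces : Table → ℕ
  faces ρ = orbitCount _≟ᵈ_ (λ d → apply ρ (flip d)) darts

  -- Euler's formula V − E + F = 2 − 2g of a connected graph with at least
  -- one edge, cleared of subtractions.
  HasGenus : ℕ → Table → Set
  HasGenus g ρ = order + faces ρ + 2 * g ≡ size + 2

  hasGenus? : ∀ g ρ → Dec (HasGenus g ρ)
  hasGenus? g ρ = order + faces ρ + 2 * g ℕ.≟ size + 2

  embeddings : ℕ → List Table
  embeddings g = filter (λ ρ → isRotation? ρ ×-dec hasGenus? g ρ) tables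

  genusPoly : Poly
  genusPoly g = length (embeddings g)

open Graph using (order; size; end; Vertex; Edge)

------------------------------------------------------------------------
-- Ladders and crosses

ends : {A : Set} → A → A → Fin 2 → A
ends u v zero       = u
ends u v (suc zero) = v

-- The new vertices order G ↑ʳ 0, order G ↑ʳ 1, … follow each other in this
-- sequence from end 0 to end 1 of e.  Of the n + 1 segments, the last one
-- keeps the name of e and the one leading to order G ↑ʳ k is size G ↑ʳ k.
subdivide : (G : Graph) → Edge G → ℕ → Graph
subdivide G e n = record
  { order = order G + n
  ; size  = size G + n
  ; end   = λ f → [ old , new ]′ (splitAt (size G) f)
  }
  where
  point : Fin (suc n) → Fin (order G + n)
  point zero    = end G e zero ↑ˡ n
  point (suc k) = order G ↑ʳ k

  new : Fin n → Fin 2 → Fin (order G + n)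
  new k = ends (point (inject₁ k)) (point (suc k))

  old : Edge G → Fin 2 → Fin (order G + n)
  old f with f Fin.≟ e
  ... | yes _ = ends (point (fromℕ n)) (end G e (suc zero) ↑ˡ n)
  ... | no  _ = λ s → end G f s ↑ˡ n

addEdges : (G : Graph) (n : ℕ) → (Fin n → Fin 2 → Vertex G) → Graph
addEdges G n new = record
  { order = order G
  ; size  = size G + n
  ; end   = λ f → [ end G , new ]′ (splitAt (size G) f)
  }

-- In case e₀ and e₁ coincide, the second subdivision acts on the last
-- segment of e₀, so that u₁, …, uₙ, v₁, …, vₙ follow each other on it.
module _ (G₀ : Graph) (e₀ e₁ : Edge G₀) (n : ℕ) where

  private
    rails : Graph
    rails = subdivide (subdivide G₀ e₀ n) (e₁ ↑ˡ n) n

    u v : Fin n → Vertex rails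
    u l = (order G₀ ↑ʳ l) ↑ˡ n
    v l = (order G₀ + n) ↑ʳ l

  ladder : Graph
  ladder = addEdges rails n (λ l → ends (u l) (v l))

  cross : Graph
  cross = addEdges rails n (λ l → ends (u l) (v (opposite l)))

------------------------------------------------------------------------
-- Surfaces given by cyclic words

-- The letter a is nothing, and a₁, …, aₙ are just 0, …, just (n ∸ 1).
Letter : ℕ → Set
Letter n = Maybe (Fin n)

Side : ℕ → Set
Side n = Letter n × Sign

pattern pos x = x , Sign.+
pattern neg x = x , Sign.-

Word : ℕ → Set
Word n = List (Side n)

module _ {n : ℕ} where

  _≟ˢ_ : DecidableEquality (Side n)
  _≟ˢ_ = Product.≡-dec (Maybe.≡-dec Fin._≟_) Sign._≟_

  inverse : Side n → Side n
  inverse (x , s) = x , Data.Sign.opposite s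

  -- The side following x in the cyclic word w (x itself if it is not in w).
  next : Word n → Side n → Side n
  next []          x = x
  next w@(h ∷ _)   x = go w
    where
    go : Word n → Side n
    go []       = x
    go (y ∷ ys) with x ≟ˢ y | ys
    ... | no  _ | _     = go ys
    ... | yes _ | []    = h
    ... | yes _ | z ∷ _ = z

  -- A corner of the polygon is named by the side x that starts there.  The
  -- identification of x with x⁻ takes it to the point where x⁻ ends, i.e. to
  -- the corner starting the side after x⁻.  The vertices of the surface are
  -- the classes generated by these identifications.
  vertices : Word n → ℕ
  vertices w = orbitCount _≟ˢ_ (λ x → next w (inverse x)) w

  -- Euler's formula V − E + 1 = 2 − 2g, where E is half the number of sides.
  WordHasGenus : ℕ → Word n → Set
  WordHasGenus g w = vertices w + 2 * g ≡ ⌊ length w /2⌋ + 1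

  wordHasGenus? : ∀ g w → Dec (WordHasGenus g w)
  wordHasGenus? g w = vertices w + 2 * g ℕ.≟ ⌊ length w /2⌋ + 1

  increasing decreasing : Subset n → List (Letter n)
  increasing S = map just (filter (_∈? S) (allFin n))
  decreasing S = reverse (increasing S)

  module _ (K T : Subset n) where

    R₁ R₂ R₃ R₄ : Word n
    R₁ = map (λ x → pos x) (decreasing K)
    R₂ = map (λ x → pos x) (increasing (∁ K))
    R₃ = map (λ x → neg x) (decreasing T)
    R₄ = map (λ x → neg x) (increasing (∁ T))

    S₁ S₆ : Word n
    S₁ = R₁ ++ R₂ ++ R₃ ++ R₄
    S₆ = [ pos nothing ] ++ R₁ ++ R₄ ++ [ neg nothing ] ++ R₂ ++ R₃

subsets : ∀ n → List (Subset n)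
subsets = allVecs (inside ∷ outside ∷ [])

-- The surfaces of a family, one for each pair (K , T), with multiplicity.
surfaces : ∀ n → (Subset n → Subset n → Word n) → List (Word n)
surfaces n S = cartesianProductWith S (subsets n) (subsets n)

surfacePoly : ∀ n → (Subset n → Subset n → Word n) → Poly
surfacePoly n S g = length (filter (wordHasGenus? g) (surfaces n S))

{-# OPTIONS --safe #-}
-- Strengthen log-concavity to aᵢ aⱼ₊₁ ≤ aᵢ₊₁ aⱼ for i ≤ j, which excludes
-- internal zeros.  The convolution of two such sequences is log-concave, by the
-- Binet–Cauchy identity, and convolution with one of them keeps unimodality,
-- since it is variation diminishing.  It thus suffices that the polynomials of
-- the ladder surfaces and, if it is log-concave, that of G₀ have the strong
-- property.
--
-- For the surfaces, attach the letters in increasing order of the index.  At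
-- each stage the ends of the new letter go to two fixed places of the polygon,
-- and inserting a side multiplies the permutation whose cycles are the vertices
-- by a transposition.  If the places lie on different vertices, two of the four
-- choices keep the genus and this situation, and two raise the genus by 1 and
-- make the places lie on one vertex; from there all four choices keep the
-- genus and lead back.  The resulting recursion preserves the strong property.
--
-- For G₀, log-concavity becomes strong because there are no gaps in the range
-- of genera (Duke): any two rotation systems are connected by steps that
-- multiply the face permutation by two transpositions, hence change the genus
-- by at most 1.

module Submission where

open import Defs
open import Data.Bool using (Bool; true; false; not)
open import Data.Fin using (Fin; zero; suc; toℕ)
import Data.Fin.Properties as Fin
open import Data.Fin.Subset using (Subset; inside; outside; ∁)
open import Data.Fin.Subset.Properties using (_∈?_)
open import Data.List using (List; []; _∷_; [_]; _++_; map; filter; reverse; length; upTo; allFin; iterate; deduplicate; cartesianProduct; cartesianProductWith; tabulate)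
open import Data.List.Membership.Propositional using (_∈_; _∉_; find; lose)
import Data.List.Membership.Propositional.Properties as Mem
import Data.List.Properties as List
open import Data.List.Relation.Binary.Permutation.Propositional using (_↭_; ↭⇒↭ₛ; ↭-sym; ↭-trans; prep)
import Data.List.Relation.Binary.Permutation.Propositional.Properties as Perm
import Data.List.Relation.Binary.Permutation.Setoid.Properties as PermSetoid
open import Data.List.Relation.Unary.All as All using (All; []; _∷_)
import Data.List.Relation.Unary.All.Properties as Allₚ
open import Data.List.Relation.Unary.AllPairs as AllPairs using (AllPairs; []; _∷_)
import Data.List.Relation.Unary.AllPairs.Properties as AllPairsₚ
open import Data.List.Relation.Unary.Any as Any using (Any; here; there; index; _─_)
import Data.List.Relation.Unary.Any.Properties as Anyₚ
open import Data.List.Relation.Unary.Unique.Propositional using (Unique)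
import Data.List.Relation.Unary.Unique.Propositional.Properties as Uniqueₚ
open import Data.Maybe using (Maybe; just; nothing)
import Data.Maybe.Properties as Maybe
open import Data.Nat using (ℕ; zero; suc; _+_; _*_; _∸_; _≤_; _<_; _≥_; z≤n; s≤s; ⌊_/2⌋; >-nonZero)
import Data.Nat.ListAction as ℕ
import Data.Nat.ListAction.Properties as ℕ
import Data.Nat.Properties as ℕ
open import Data.Nat.Solver using (module +-*-Solver)
open import Data.Product using (∃-syntax; _×_; _,_; proj₁; proj₂)
open import Data.Sign using (Sign)
open import Data.Sum using (_⊎_; inj₁; inj₂)
open import Data.Vec using (Vec; lookup) renaming ([] to []ᵛ; _∷_ to _∷ᵛ_)
import Data.Vec as Vec
import Data.Vec.Properties as Vec
open import Function using (_∘_; id)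
open import Function.Definitions using (Injective)
open import Relation.Binary.Definitions using (DecidableEquality)
open import Relation.Binary.PropositionalEquality using (_≡_; _≢_; _≗_; refl; setoid; sym; trans; cong; cong₂; subst; subst₂; module ≡-Reasoning)
open import Relation.Nullary using (Dec; yes; no; ¬_; ¬?; contradiction)
open import Relation.Nullary.Decidable using (_×-dec_)

-- Orbits of a permutation of a finite set

-- The newest letter always stands at the front of R₁ or the end of R₂, and its inverse at the front
-- of R₃ or the end of R₄, because the products with decreasing indices grow to the left and those
-- with increasing indices to the right. Hence old sides never have to be reordered. An obstacle is
-- that the set of sides grows with each letter. All vertex permutations are therefore taken on the
-- fixed set of all sides of all letters. A letter not yet attached contributes one orbit, and
-- attaching it multiplies by exactly two transpositions of an unchanging set. With a for `apart`
-- and b for `joined`, the recursion is a′ = 2a + 2xb, b′ = 4a. A sum of two strongly log-concave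
-- sequences need not be log-concave, so two mixed inequalities between a and b are carried along.

private
  variable
    A B : Set

_─∋_ : {xs : List A} {x y : A} (p : x ∈ xs) → y ∈ xs → y ≢ x → y ∈ (xs ─ p)
(here refl ─∋ here refl) y≢x = contradiction refl y≢x
(here refl ─∋ there q)   y≢x = q
(there p   ─∋ here refl) y≢x = here refl
(there p   ─∋ there q)   y≢x = there ((p ─∋ q) y≢x)

length-─ : {xs : List A} {x : A} (p : x ∈ xs) → length xs ≡ suc (length (xs ─ p))
length-─ (here _)  = refl
length-─ (there p) = cong suc (length-─ p)

iter : (A → A) → ℕ → A → A
iter f zero    x = x
iter f (suc k) x = iter f k (f x)

module _ (f : A → A) where

  iter-+ : ∀ m n x → iter f (m + n) x ≡ iter f n (iter f m x)
  iter-+ zero    n x = refl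
  iter-+ (suc m) n x = iter-+ m n (f x)

  iter-suc : ∀ k x → iter f (suc k) x ≡ f (iter f k x)
  iter-suc zero    x = refl
  iter-suc (suc k) x = iter-suc k (f x)

  iter-closed : {P : A → Set} → (∀ {x} → P x → P (f x)) → ∀ k {x} → P x → P (iter f k x)
  iter-closed     c zero    p = p
  iter-closed {P} c (suc k) p = iter-closed {P} c k (c p)

  iter-injective : Injective _≡_ _≡_ f → ∀ k → Injective _≡_ _≡_ (iter f k)
  iter-injective inj zero    eq = eq
  iter-injective inj (suc k) eq = inj (iter-injective inj k eq)

  ∈-iterate⁻ : ∀ n {x y} → y ∈ iterate f x n → ∃[ k ] iter f k x ≡ y
  ∈-iterate⁻ (suc n) (here refl) = 0 , refl
  ∈-iterate⁻ (suc n) (there p)   with k , eq ← ∈-iterate⁻ n p = suc k , eq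

  ∈-iterate⁺ : ∀ {n k} x → k < n → iter f k x ∈ iterate f x n
  ∈-iterate⁺ {suc n} {zero}  x _         = here refl
  ∈-iterate⁺ {suc n} {suc k} x (s≤s k<n) = there (∈-iterate⁺ (f x) k<n)

  -- Pigeonhole: two of the first `length xs + 1` iterates coincide, and injectivity cancels the
  -- steps before the earlier one. The bound by `length xs` makes the cut-off in `InOrbit` harmless.
  period : ∀ {xs} → Injective _≡_ _≡_ f → (∀ {x} → x ∈ xs → f x ∈ xs) →
           ∀ {x} → x ∈ xs → ∃[ d ] suc d ≤ length xs × iter f (suc d) x ≡ x
  period {xs} inj closed {x} x∈xs =
    let i , j , i<j , eq = Fin.pigeonhole (ℕ.n<1+n (length xs)) (λ i → index (visit (toℕ i)))
        d       = toℕ j ∸ suc (toℕ i)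
        shift   = trans (sym (ℕ.+-suc d (toℕ i))) (ℕ.m∸n+n≡m i<j)
        returns = trans (Anyₚ.lookup-index (visit (toℕ i)))
                    (trans (cong (Data.List.lookup xs) eq) (sym (Anyₚ.lookup-index (visit (toℕ j)))))
    in d
     , ℕ.≤-trans (ℕ.m≤m+n (suc d) (toℕ i)) (ℕ.≤-trans (ℕ.≤-reflexive shift) (ℕ.≤-pred (Fin.toℕ<n j)))
     , iter-injective inj (toℕ i) (trans (sym (iter-+ (suc d) (toℕ i) x))
         (trans (cong (λ k → iter f k x) shift) (sym returns)))
    where
    visit : ∀ k → iter f k x ∈ xs
    visit k = iter-closed {_∈ xs} closed k x∈xs

  iter-mod : ∀ {d x} → iter f (suc d) x ≡ x → ∀ k → ∃[ r ] r ≤ d × iter f k x ≡ iter f r x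
  iter-mod ret zero = 0 , z≤n , refl
  iter-mod {d} {x} ret (suc k) with iter-mod ret k
  ... | r , r≤d , eq with ℕ.m≤n⇒m<n∨m≡n r≤d
  ...   | inj₁ r<d  = suc r , r<d , trans (iter-suc k x) (trans (cong f eq) (sym (iter-suc r x)))
  ...   | inj₂ refl = 0 , z≤n , trans (iter-suc k x) (trans (cong f eq) (trans (sym (iter-suc r x)) ret))

Reach : (A → A) → A → A → Set
Reach f x y = ∃[ k ] iter f k x ≡ y

module _ {f : A → A} where

  reach-refl : ∀ {x} → Reach f x x
  reach-refl = 0 , refl

  reach-≡ : ∀ {x y} → x ≡ y → Reach f x y
  reach-≡ eq = 0 , eq

  reach-step : ∀ {x y} → f x ≡ y → Reach f x y
  reach-step eq = 1 , eq

  reach-trans : ∀ {x y z} → Reach f x y → Reach f y z → Reach f x z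
  reach-trans {x} (k , refl) (l , eq) = k + l , trans (iter-+ f k l x) eq

  reach-inv : {P : A → Set} → (∀ {x} → P x → P (f x)) → ∀ {x y} → Reach f x y → P x → P y
  reach-inv {P} c (k , refl) = iter-closed f {P} c k

iter-cong : {f g : A → A} → f ≗ g → ∀ k x → iter f k x ≡ iter g k x
iter-cong             eq zero    x = refl
iter-cong {f = f} {g} eq (suc k) x = trans (cong (iter f k) (eq x)) (iter-cong eq k (g x))

reach-cong : {f g : A → A} → f ≗ g → ∀ {x y} → Reach f x y → Reach g x y
reach-cong eq (k , p) = k , trans (sym (iter-cong eq k _)) p

reach-map : {f g : A → A} → (∀ x → Reach g x (f x)) → ∀ {x y} → Reach f x y → Reach g x y
reach-map {f = f} {g} s {x} r = reach-inv {P = Reach g x} (λ p → reach-trans p (s _)) r reach-refl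

least : {P : ℕ → Set} → (∀ k → Dec (P k)) → ∀ k → P k → ∃[ m ] P m × (∀ j → j < m → ¬ P j)
least P? zero    p = 0 , p , λ _ ()
least P? (suc k) p with P? 0
... | yes p₀ = 0 , p₀ , λ _ ()
... | no ¬p₀ with m , q , min ← least (P? ∘ suc) k p =
  suc m , q , λ { zero _ → ¬p₀ ; (suc j) (s≤s j<m) → min j j<m }

-- Orbit counts and products with a transposition

module Orbits (_≟_ : DecidableEquality A) where

  swap : A → A → A → A
  swap a b x with x ≟ a | x ≟ b
  ... | yes _ | _     = b
  ... | no  _ | yes _ = a
  ... | no  _ | no  _ = x

  swap-left : ∀ a b → swap a b a ≡ b
  swap-left a b with a ≟ a | a ≟ b
  ... | yes _  | _ = refl
  ... | no a≢a | _ = contradiction refl a≢a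

  swap-right : ∀ a b → swap a b b ≡ a
  swap-right a b with b ≟ a | b ≟ b
  ... | yes b≡a | _ = b≡a
  ... | no  _   | yes _ = refl
  ... | no  _   | no b≢b = contradiction refl b≢b

  swap-other : ∀ {a b x} → x ≢ a → x ≢ b → swap a b x ≡ x
  swap-other {a} {b} {x} x≢a x≢b with x ≟ a | x ≟ b
  ... | yes x≡a | _       = contradiction x≡a x≢a
  ... | no  _   | yes x≡b = contradiction x≡b x≢b
  ... | no  _   | no  _   = refl

  data SwapCase (a b x : A) : Set where
    left  : x ≡ a → swap a b x ≡ b → SwapCase a b x
    right : x ≡ b → swap a b x ≡ a → SwapCase a b x
    other : x ≢ a → x ≢ b → swap a b x ≡ x → SwapCase a b x

  swapCase : ∀ a b x → SwapCase a b x
  swapCase a b x with x ≟ a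
  ... | yes refl = left refl (swap-left a b)
  ... | no x≢a with x ≟ b
  ...   | yes refl = right refl (swap-right a b)
  ...   | no x≢b   = other x≢a x≢b (swap-other x≢a x≢b)

  swap-involutive : ∀ a b x → swap a b (swap a b x) ≡ x
  swap-involutive a b x with swapCase a b x
  ... | left  refl eq   = trans (cong (swap a b) eq) (swap-right a b)
  ... | right refl eq   = trans (cong (swap a b) eq) (swap-left a b)
  ... | other _    _ eq = trans (cong (swap a b) eq) eq

  swap-injective : ∀ a b → Injective _≡_ _≡_ (swap a b)
  swap-injective a b {x} {y} eq = trans (sym (swap-involutive a b x))
      (trans (cong (swap a b) eq) (swap-involutive a b y))

  module _ {f : A → A} (inj : Injective _≡_ _≡_ f) where

    reach⇒inOrbit : ∀ {xs} → (∀ {x} → x ∈ xs → f x ∈ xs) → ∀ {x y} → x ∈ xs → Reach f x y → InOrbit _≟_ f xs x y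
    reach⇒inOrbit closed {x} x∈xs (k , refl)
      with d , d<n , ret ← period f inj closed x∈xs
      with r , r≤d , eq ← iter-mod f ret k
      = subst (_∈ _) (sym eq) (∈-iterate⁺ f x (ℕ.≤-trans (s≤s r≤d) d<n))

  inOrbit⇒reach : ∀ f xs {x y} → InOrbit _≟_ f xs x y → Reach f x y
  inOrbit⇒reach f xs = ∈-iterate⁻ f (length xs)

  -- Orbits are counted by arbitrary systems of representatives, so that a list adapted to a change
  -- of the permutation can be exhibited in place of the one found by `deduplicate`.
  record Transversal (f : A → A) (ts : List A) : Set where
    constructor transversal
    field
      cover : ∀ x → ∃[ t ] t ∈ ts × Reach f t x
      indep : AllPairs (λ s t → ¬ Reach f s t) ts

  module Finite (xs : List A) (complete : ∀ x → x ∈ xs) where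

    module _ {f : A → A} (inj : Injective _≡_ _≡_ f) where

      -- A permutation of a finite set returns to `x`, so the rest of the period leads back from
      -- `y`.
      reach-sym : ∀ {x y} → Reach f x y → Reach f y x
      reach-sym {x} (k , refl)
        with d , _ , ret ← period f inj (λ {y} _ → complete (f y)) (complete x)
        with r , r≤d , eq ← iter-mod f ret k
        = suc d ∸ r , trans (cong (iter f (suc d ∸ r)) eq)
            (trans (sym (iter-+ f r (suc d ∸ r) x)) (trans (cong (λ k → iter f k x) (ℕ.m+[n∸m]≡n (ℕ.m≤n⇒m≤1+n r≤d)))
                ret))

      reach? : ∀ x y → Dec (Reach f x y)
      reach? x y with inOrbit? _≟_ f xs x y
      ... | yes p = yes (inOrbit⇒reach f xs p)
      ... | no ¬p = no (¬p ∘ reach⇒inOrbit inj (λ _ → complete _) (complete x))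

      -- Each `t` uses up some `u` that reaches it. The same `u` cannot serve a later `t′`, since
      -- `t` would then reach `t′`.
      transversal-≤ : ∀ {ts us} → AllPairs (λ s t → ¬ Reach f s t) ts →
        (∀ {t} → t ∈ ts → ∃[ u ] u ∈ us × Reach f u t) → length ts ≤ length us
      transversal-≤ {[]}     []         c = z≤n
      transversal-≤ {t ∷ ts} {us} (¬t ∷ ind) c with u , p , u→t ← c (here refl) =
        subst (suc (length ts) ≤_) (sym (length-─ p)) (s≤s (transversal-≤ ind λ t′∈ts →
          let v , q , v→t′ = c (there t′∈ts) in
          v , (p ─∋ q) (λ { refl → All.lookup ¬t t′∈ts (reach-trans (reach-sym u→t) v→t′) }) , v→t′))

      transversal-length : ∀ {ts us} → Transversal f ts → Transversal f us → length ts ≡ length us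
      transversal-length t u = ℕ.≤-antisym (le t u) (le u t)
        where
        le : ∀ {ts us} → Transversal f ts → Transversal f us → length ts ≤ length us
        le t u = transversal-≤ (Transversal.indep t) (λ {x} _ → Transversal.cover u x)

    deduplicate-cover : ∀ {f} {R : A → A → Set} (R? : ∀ x y → Dec (R x y)) → (∀ {x y} → R x y → Reach f x y) →
      ∀ {ys x} → x ∈ ys → ∃[ t ] t ∈ deduplicate R? ys × Reach f t x
    deduplicate-cover {f} R? sound {ys} {x} x∈ys = find
        (Anyₚ.deduplicate⁺ R? {P = λ t → Reach f t x} (λ r p → reach-trans (sound r) p) (lose x∈ys reach-refl))

    deduplicate-indep : {R : A → A → Set} (R? : ∀ x y → Dec (R x y)) → ∀ ys → AllPairs (λ s t → ¬ R s t)
        (deduplicate R? ys)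
    deduplicate-indep R? []       = []
    deduplicate-indep R? (y ∷ ys) = Allₚ.all-filter (¬? ∘ R? y) (deduplicate R? ys) ∷ AllPairsₚ.filter⁺ (¬? ∘ R? y)
        (deduplicate-indep R? ys)

    count : (A → A) → ℕ
    count f = orbitCount _≟_ f xs

    module _ {f : A → A} (inj : Injective _≡_ _≡_ f) where

      transversal-count : ∀ {ts} → Transversal f ts → length ts ≡ count f
      transversal-count t = transversal-length inj t (transversal
        (λ x → deduplicate-cover (inOrbit? _≟_ f xs) (inOrbit⇒reach f xs) (complete x))
        (AllPairs.map (λ ¬o r → ¬o (reach⇒inOrbit inj (λ _ → complete _) (complete _) r))
            (deduplicate-indep (inOrbit? _≟_ f xs) xs)))

      -- `deduplicate` keeps the first entry, so listing `x` once more in front makes it a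
      -- representative.
      transversal-from : ∀ x → ∃[ ts ] Transversal f (x ∷ ts)
      transversal-from x = _ , transversal
        (λ y → deduplicate-cover (reach? inj) id {x ∷ xs} (there (complete y)))
        (deduplicate-indep (reach? inj) (x ∷ xs))

    count-cong : ∀ {f g} → Injective _≡_ _≡_ f → Injective _≡_ _≡_ g → f ≗ g → count f ≡ count g
    count-cong {f} {g} injf injg eq = trans (sym (transversal-count injf t)) (transversal-count injg (transversal
        (λ x → let s , m , r = Transversal.cover t x in s , m , reach-cong eq r)
        (AllPairs.map (λ ¬r r → ¬r (reach-cong (sym ∘ eq) r)) (Transversal.indep t))))
      where
      t : Transversal f (deduplicate (reach? injf) xs)
      t = transversal (λ x → deduplicate-cover (reach? injf) id (complete x)) (deduplicate-indep (reach? injf) xs)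

    module _ {f : A → A} (inj : Injective _≡_ _≡_ f) {a b : A} where

      swapped : A → A
      swapped x = swap a b (f x)

      swapped-injective : Injective _≡_ _≡_ swapped
      swapped-injective = inj ∘ swap-injective a b

      unswap : ∀ x → swap a b (swapped x) ≡ f x
      unswap x = swap-involutive a b (f x)

      refines : Reach f a b → ∀ {x y} → Reach swapped x y → Reach f x y
      refines a~b = reach-map step
        where
        step : ∀ x → Reach f x (swapped x)
        step x with swapCase a b (f x)
        ... | left  eq eq′ = reach-trans (reach-step eq) (reach-trans a~b (reach-≡ (sym eq′)))
        ... | right eq eq′ = reach-trans (reach-step eq) (reach-trans (reach-sym inj a~b) (reach-≡ (sym eq′)))
        ... | other _ _ eq = reach-step (sym eq)

      Touched : A → Set
      Touched x = Reach swapped a x ⊎ Reach swapped b x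

      -- The two permutations differ only where `f` enters `a` or `b`. After its last such entry a
      -- path of `f` is a path of `swapped`.
      touched-or-kept : ∀ {x y} → Reach f x y → Touched y ⊎ Reach swapped x y
      touched-or-kept {x} r = reach-inv {P = λ y → Touched y ⊎ Reach swapped x y} step r (inj₂ reach-refl)
        where
        step : ∀ {y} → Touched y ⊎ Reach swapped x y → Touched (f y) ⊎ Reach swapped x (f y)
        step {y} p with swapCase a b (f y)
        ... | left  eq _ = inj₁ (inj₁ (reach-≡ (sym eq)))
        ... | right eq _ = inj₁ (inj₂ (reach-≡ (sym eq)))
        step {y} (inj₁ (inj₁ p)) | other _ _ eq = inj₁ (inj₁ (reach-trans p (reach-step eq)))
        step {y} (inj₁ (inj₂ p)) | other _ _ eq = inj₁ (inj₂ (reach-trans p (reach-step eq)))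
        step {y} (inj₂ p)        | other _ _ eq = inj₂ (reach-trans p (reach-step eq))

      -- Let `suc m` be the first time at which `f` takes `a` to `b`. The points met at times 0 to
      -- `m` are closed under `swapped`, because the step that would enter `b` is redirected to `a`.
      separates : a ≢ b → Reach f a b → ¬ Reach swapped a b
      separates a≢b (k , eq) a~b with least (λ k → iter f k a ≟ b) k eq
      ... | zero  , a≡b , _   = a≢b a≡b
      ... | suc m , hit , min = let j , j≤m , e = reach-inv {P = Before} stays a~b (0 , z≤n , refl) in min j (s≤s j≤m) e
        where
        Before : A → Set
        Before x = ∃[ j ] j ≤ m × iter f j a ≡ x
        stays : ∀ {x} → Before x → Before (swapped x)
        stays (j , j≤m , refl) with swapCase a b (f (iter f j a))
        ... | right _ eq = 0 , z≤n , sym eq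
        -- A return to `a` by that time could be cut out, giving an earlier arrival at `b`.
        ... | left back eq′ = contradiction
              (trans (sym (trans (cong (λ i → iter f i a) split) (iter-+ f (suc j) (m ∸ j) a)))
                     hit)
              (λ e → min (m ∸ j) (s≤s (ℕ.m∸n≤m m j)) (trans (cong (iter f (m ∸ j))
                  (sym (trans (iter-suc f j a) back))) e))
          where
          split : suc m ≡ suc j + (m ∸ j)
          split = cong suc (sym (ℕ.m+[n∸m]≡n j≤m))
        ... | other _ ≢b eq with ℕ.m≤n⇒m<n∨m≡n j≤m
        ...   | inj₁ j<m  = suc j , j<m , trans (iter-suc f j a) (sym eq)
        ...   | inj₂ refl = contradiction (trans (sym (iter-suc f j a)) hit) ≢b

      count-split : a ≢ b → Reach f a b → count swapped ≡ suc (count f)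
      count-split a≢b a~b with ts , transversal cov (¬a ∷ ind) ← transversal-from inj a =
        trans (sym (transversal-count swapped-injective (transversal cov′ ind′)))
            (cong suc (transversal-count inj (transversal cov (¬a ∷ ind))))
        where
        cov′ : ∀ x → ∃[ t ] t ∈ a ∷ b ∷ ts × Reach swapped t x
        cov′ x with cov x
        ... | t , t∈ , t~x with touched-or-kept t~x
        ...   | inj₁ (inj₁ r) = a , here refl , r
        ...   | inj₁ (inj₂ r) = b , there (here refl) , r
        cov′ x | t , here refl , t~x | inj₂ r = a , here refl , r
        cov′ x | t , there t∈ , t~x | inj₂ r = t , there (there t∈) , r
        ind′ : AllPairs (λ s t → ¬ Reach swapped s t) (a ∷ b ∷ ts)
        ind′ = (separates a≢b a~b ∷ All.map (λ ¬r r → ¬r (refines a~b r)) ¬a)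
             ∷ All.map (λ ¬r r → ¬r (reach-trans a~b (refines a~b r))) ¬a
             ∷ AllPairs.map (λ ¬r r → ¬r (refines a~b r)) ind

      -- Follow `f` from `b` to the last point before it returns: there `swapped` goes to `a`
      -- instead. No earlier step is redirected, since the orbit of `b` does not contain `a`.
      joins : ¬ Reach f a b → Reach swapped a b
      joins ¬a~b with d , _ , ret ← period f inj (λ _ → complete _) (complete b)
                 with k , back , min ← least (λ k → iter f (suc k) b ≟ b) d ret
        = reach-sym swapped-injective (reach-trans (follow k ℕ.≤-refl)
            (reach-step (trans (cong (swap a b) (trans (sym (iter-suc f k b)) back)) (swap-right a b))))
        where
        follow : ∀ j → j ≤ k → Reach swapped b (iter f j b)
        follow zero    _   = reach-refl
        follow (suc j) j<k with swapCase a b (f (iter f j b))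
        ... | left  ≡a _   = contradiction (reach-sym inj (suc j , trans (iter-suc f j b) ≡a)) ¬a~b
        ... | right ≡b _   = contradiction (trans (iter-suc f j b) ≡b) (min j j<k)
        ... | other _ _ eq = reach-trans (follow j (ℕ.<⇒≤ j<k)) (reach-step (trans eq (sym (iter-suc f j b))))

    module _ {f : A → A} (inj : Injective _≡_ _≡_ f) {a b : A} (¬a~b : ¬ Reach f a b) where

      private
        inj′ = swapped-injective inj {a} {b}

      coarsens : ∀ {x y} → Reach f x y → Reach (swapped inj {a} {b}) x y
      coarsens r = refines inj′ (joins inj ¬a~b) (reach-cong (sym ∘ unswap inj) r)

      -- `swap a b` undoes itself, so this is `count-split` read backwards.
      count-join : count f ≡ suc (count (swapped inj {a} {b}))
      count-join = trans (count-cong inj (swapped-injective inj′) (sym ∘ unswap inj))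
        (count-split inj′ (λ a≡b → ¬a~b (reach-≡ a≡b)) (joins inj ¬a~b))

    -- The effect on the orbits of attaching the ends n and m of a new letter,
    -- so far forming an orbit of their own, at h₁ and h₂.
    module Attach {f : A → A} (inj : Injective _≡_ _≡_ f) {n m : A} (fn : f n ≡ m) (fm : f m ≡ n) (n≢m : n ≢ m)
        {h₁ h₂ : A}
             (h₁≢n : h₁ ≢ n) (h₁≢m : h₁ ≢ m) (h₂≢n : h₂ ≢ n) (h₂≢m : h₂ ≢ m) where

      half attached : A → A
      half     x = swap h₁ n (f x)
      attached x = swap h₂ m (half x)

      half-injective : Injective _≡_ _≡_ half
      half-injective = swapped-injective inj

      attached-injective : Injective _≡_ _≡_ attached
      attached-injective = swapped-injective half-injective

      half-n : half n ≡ m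
      half-n = trans (cong (swap h₁ n) fn) (swap-other (h₁≢m ∘ sym) (n≢m ∘ sym))

      half-m : half m ≡ h₁
      half-m = trans (cong (swap h₁ n) fm) (swap-right h₁ n)

      attached-n : attached n ≡ h₂
      attached-n = trans (cong (swap h₂ m) half-n) (swap-right h₂ m)

      attached-m : h₁ ≢ h₂ → attached m ≡ h₁
      attached-m h₁≢h₂ = trans (cong (swap h₂ m) half-m) (swap-other h₁≢h₂ h₁≢m)

      attached-fixes-m : h₁ ≡ h₂ → attached m ≡ m
      attached-fixes-m refl = trans (cong (swap h₂ m) half-m) (swap-left h₂ m)

      private
        Old : A → Set
        Old x = x ≢ n × x ≢ m

        old-closed : ∀ {x} → Old x → Old (f x)
        old-closed (x≢n , x≢m) = (λ eq → x≢m (inj (trans eq (sym fm)))) , (λ eq → x≢n (inj (trans eq (sym fn))))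

        ¬h₁~n : ¬ Reach f h₁ n
        ¬h₁~n r = proj₁ (reach-inv {P = Old} old-closed r (h₁≢n , h₁≢m)) refl

        half-joins : count f ≡ suc (count half)
        half-joins = count-join inj ¬h₁~n

      attach-split : Reach f h₂ h₁ → count attached ≡ count f × ¬ Reach attached h₂ m
      attach-split h₂~h₁ = trans (count-split half-injective h₂≢m h₂~m) (sym half-joins) , separates half-injective
          h₂≢m h₂~m
        where
        h₂~m : Reach half h₂ m
        h₂~m = reach-trans (coarsens inj ¬h₁~n h₂~h₁) (reach-sym half-injective (reach-step half-m))

      module _ (¬h₂~h₁ : ¬ Reach f h₂ h₁) where

        private
          -- On the orbits of `f` other than those of `h₁` and of the new letter, `half` agrees with
          -- `f`. Hence `h₂` cannot yet reach `m`.
          Away : A → Set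
          Away x = Old x × ¬ Reach f x h₁

          away-closed : ∀ {x} → Away x → Away (half x)
          away-closed {x} (old , ¬r) with old-closed old | swapCase h₁ n (f x)
          ... | old′ | left  eq _    = contradiction (reach-step eq) ¬r
          ... | old′ | right eq _    = contradiction eq (proj₁ old′)
          ... | old′ | other _ _ eq  = subst Away (sym eq) (old′ , λ r → ¬r (reach-trans (reach-step refl) r))

          ¬h₂~m : ¬ Reach half h₂ m
          ¬h₂~m r = proj₂ (proj₁ (reach-inv {P = Away} away-closed r ((h₂≢n , h₂≢m) , ¬h₂~h₁))) refl

        attach-joins : Reach attached h₂ m
        attach-joins = joins half-injective ¬h₂~m

        attach-joins-h : Reach attached h₂ h₁
        attach-joins-h = reach-trans attach-joins (coarsens half-injective ¬h₂~m (reach-step half-m))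

        attach-count : count f ≡ 2 + count attached
        attach-count = trans half-joins (cong suc (count-join half-injective ¬h₂~m))

-- Convolution of log-concave and unimodal sequences

∑ : ℕ → (ℕ → ℕ) → ℕ
∑ zero    f = 0
∑ (suc n) f = ∑ n f + f n

∑-upTo : ∀ n f → ℕ.sum (map f (upTo n)) ≡ ∑ n f
∑-upTo zero    f = refl
∑-upTo (suc n) f = begin
  ℕ.sum (map f (upTo (suc n)))               ≡⟨ cong (ℕ.sum ∘ map f) (List.applyUpTo-∷ʳ id n) ⟨
  ℕ.sum (map f (upTo n ++ n ∷ []))           ≡⟨ cong ℕ.sum (List.map-++ f (upTo n) (n ∷ [])) ⟩
  ℕ.sum (map f (upTo n) ++ f n ∷ [])         ≡⟨ ℕ.sum-++ (map f (upTo n)) (f n ∷ []) ⟩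
  ℕ.sum (map f (upTo n)) + (f n + 0)         ≡⟨ cong₂ _+_ (∑-upTo n f) (ℕ.+-identityʳ (f n)) ⟩
  ∑ n f + f n                                ∎
  where open ≡-Reasoning

∑-cong : ∀ n {f g} → (∀ i → i < n → f i ≡ g i) → ∑ n f ≡ ∑ n g
∑-cong zero    eq = refl
∑-cong (suc n) eq = cong₂ _+_ (∑-cong n λ i i<n → eq i (ℕ.m<n⇒m<1+n i<n)) (eq n ℕ.≤-refl)

∑-mono : ∀ n {f g} → (∀ i → f i ≤ g i) → ∑ n f ≤ ∑ n g
∑-mono zero    le = z≤n
∑-mono (suc n) le = ℕ.+-mono-≤ (∑-mono n le) (le n)

∑-+ : ∀ n f g → ∑ n (λ i → f i + g i) ≡ ∑ n f + ∑ n g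
∑-+ zero    f g = refl
∑-+ (suc n) f g = trans (cong (_+ (f n + g n)) (∑-+ n f g))
    (solve 4 (λ a b c d → (a :+ b) :+ (c :+ d) := (a :+ c) :+ (b :+ d)) refl (∑ n f) (∑ n g) (f n) (g n))
  where open +-*-Solver

∑-*ˡ : ∀ n x f → x * ∑ n f ≡ ∑ n (λ i → x * f i)
∑-*ˡ zero    x f = ℕ.*-zeroʳ x
∑-*ˡ (suc n) x f = trans (ℕ.*-distribˡ-+ x (∑ n f) (f n)) (cong (_+ x * f n) (∑-*ˡ n x f))

∑-*ʳ : ∀ n x f → ∑ n f * x ≡ ∑ n (λ i → f i * x)
∑-*ʳ zero    x f = refl
∑-*ʳ (suc n) x f = trans (ℕ.*-distribʳ-+ x (∑ n f) (f n)) (cong (_+ f n * x) (∑-*ʳ n x f))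

∑-head : ∀ n f → ∑ (suc n) f ≡ f 0 + ∑ n (f ∘ suc)
∑-head zero    f = ℕ.+-comm 0 (f 0)
∑-head (suc n) f = trans (cong (_+ f (suc n)) (∑-head n f)) (ℕ.+-assoc (f 0) (∑ n (f ∘ suc)) (f (suc n)))

∑-extend : ∀ m n f → (∀ i → m ≤ i → f i ≡ 0) → m ≤ n → ∑ n f ≡ ∑ m f
∑-extend m zero    f z z≤n = refl
∑-extend m (suc n) f z m≤n with ℕ.m≤n⇒m<n∨m≡n m≤n
... | inj₂ refl      = refl
... | inj₁ (s≤s m≤n) = trans (cong₂ _+_ (∑-extend m n f z m≤n) (z n m≤n)) (ℕ.+-identityʳ _)

∑*∑-mono : ∀ n {a b c d} → (∀ i j → a i * b j ≤ c i * d j) → ∑ n a * ∑ n b ≤ ∑ n c * ∑ n d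
∑*∑-mono n {a} {b} {c} {d} le = ℕ.≤-trans (ℕ.≤-reflexive (expand a b))
    (ℕ.≤-trans (∑-mono n λ i → ∑-mono n (le i)) (ℕ.≤-reflexive (sym (expand c d))))
  where
  expand : ∀ a b → ∑ n a * ∑ n b ≡ ∑ n (λ i → ∑ n (λ j → a i * b j))
  expand a b = trans (∑-*ʳ n (∑ n b) a) (∑-cong n λ i _ → ∑-*ˡ n (a i) b)

-- The difference of the two sides is the product of `b − a` and `d − c`.
rearrange : ∀ {a b c d} → a ≤ b → c ≤ d → a * d + b * c ≤ a * c + b * d
rearrange {a} {b} {c} {d} a≤b c≤d = ℕ.≤-trans (ℕ.m≤m+n _ (s * t)) (ℕ.≤-reflexive (begin
    (a * d + b * c) + s * t                           ≡⟨ cong₂ (λ d b → (a * d + b * c) + s * t) (sym ct) (sym as) ⟩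
    (a * (c + t) + (a + s) * c) + s * t
        ≡⟨ solve 4 (λ a c s t → (a :* (c :+ t) :+ (a :+ s) :* c) :+ s :* t := a :* c :+ (a :+ s) :* (c :+ t)) refl a
        c s t ⟩
    a * c + (a + s) * (c + t)                         ≡⟨ cong₂ (λ b d → a * c + b * d) as ct ⟩
    a * c + b * d                                     ∎))
  where
  open ≡-Reasoning
  open +-*-Solver
  s  = b ∸ a
  t  = d ∸ c
  as : a + s ≡ b
  as = ℕ.m+[n∸m]≡n a≤b
  ct : c + t ≡ d
  ct = ℕ.m+[n∸m]≡n c≤d

module _ {P P′ Q Q′ : ℕ → ℕ}
         (P-minor : ∀ {i j} → i < j → P i * P′ j ≤ P j * P′ i)
         (Q-minor : ∀ {i j} → i < j → Q′ i * Q j ≤ Q i * Q′ j) where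

  private
    PQ   = λ i → P i * Q i
    P′Q′ = λ i → P′ i * Q′ i
    PQ′  = λ i → P i * Q′ i
    P′Q  = λ i → P′ i * Q i

  -- By the Binet–Cauchy identity the difference of the two sides is a sum of
  -- products of a minor of (P , P′) and a minor of (Q , Q′).
  binet-cauchy : ∀ n → ∑ n PQ * ∑ n P′Q′ ≤ ∑ n PQ′ * ∑ n P′Q
  binet-cauchy zero    = z≤n
  binet-cauchy (suc n) = begin
      (∑ n PQ + p * q) * (∑ n P′Q′ + p′ * q′)
        ≡⟨ expand (∑ n PQ) (∑ n P′Q′) p q p′ q′ ⟩
      ∑ n PQ * ∑ n P′Q′ + (∑ n PQ * (p′ * q′) + ∑ n P′Q′ * (p * q)) + p * q * (p′ * q′)
        ≤⟨ ℕ.+-mono-≤ (ℕ.+-mono-≤ (binet-cauchy n) (mixed n ℕ.≤-refl)) (ℕ.≤-reflexive (last p q p′ q′)) ⟩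
      ∑ n PQ′ * ∑ n P′Q + (∑ n PQ′ * (p′ * q) + ∑ n P′Q * (p * q′)) + p * q′ * (p′ * q)
        ≡⟨ expand (∑ n PQ′) (∑ n P′Q) p q′ p′ q ⟨
      (∑ n PQ′ + p * q′) * (∑ n P′Q + p′ * q) ∎
    where
    open ℕ.≤-Reasoning
    open +-*-Solver
    p  = P n
    p′ = P′ n
    q  = Q n
    q′ = Q′ n
    expand : ∀ x y p q p′ q′ → (x + p * q) * (y + p′ * q′) ≡ x * y + (x * (p′ * q′) + y * (p * q)) + p * q * (p′ * q′)
    expand = solve 6 (λ x y p q p′ q′ → (x :+ p :* q) :* (y :+ p′ :* q′) := x :* y :+
        (x :* (p′ :* q′) :+ y :* (p :* q)) :+ p :* q :* (p′ :* q′)) refl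
    last : ∀ p q p′ q′ → p * q * (p′ * q′) ≡ p * q′ * (p′ * q)
    last = solve 4 (λ p q p′ q′ → p :* q :* (p′ :* q′) := p :* q′ :* (p′ :* q)) refl
    regroup : ∀ x y x′ y′ i j i′ j′ → (x + i * i′) * j + (y + y′ * x′) * j′ ≡ (x * j + y * j′) +
        (i * i′ * j + y′ * x′ * j′)
    regroup = solve 8 (λ x y x′ y′ i j i′ j′ → (x :+ i :* i′) :* j :+ (y :+ y′ :* x′) :* j′ :=
        (x :* j :+ y :* j′) :+ (i :* i′ :* j :+ y′ :* x′ :* j′)) refl
    termˡ : ∀ a b c d p q p′ q′ → a * c * (p′ * q′) + b * d * (p * q) ≡ a * p′ * (c * q′) + p * b * (d * q)
    termˡ = solve 8 (λ a b c d p q p′ q′ → a :* c :* (p′ :* q′) :+ b :* d :* (p :* q) := a :* p′ :* (c :* q′) :+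
        p :* b :* (d :* q)) refl
    termʳ : ∀ a b c d p q p′ q′ → a * p′ * (d * q) + p * b * (c * q′) ≡ a * d * (p′ * q) + b * c * (p * q′)
    termʳ = solve 8 (λ a b c d p q p′ q′ → a :* p′ :* (d :* q) :+ p :* b :* (c :* q′) := a :* d :* (p′ :* q) :+ b :*
        c :* (p :* q′)) refl
    -- The new index `n` is paired with every earlier index. Each pair contributes a product of two
    -- minors, which is nonnegative by `rearrange`.
    mixed : ∀ m → m ≤ n → ∑ m PQ * (p′ * q′) + ∑ m P′Q′ * (p * q) ≤ ∑ m PQ′ * (p′ * q) + ∑ m P′Q * (p * q′)
    mixed zero    _   = z≤n
    mixed (suc m) m<n = begin
      (∑ m PQ + P m * Q m) * (p′ * q′) + (∑ m P′Q′ + P′ m * Q′ m) * (p * q)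
        ≡⟨ regroup (∑ m PQ) (∑ m P′Q′) (Q′ m) (P′ m) (P m) (p′ * q′) (Q m) (p * q) ⟩
      (∑ m PQ * (p′ * q′) + ∑ m P′Q′ * (p * q)) + (P m * Q m * (p′ * q′) + P′ m * Q′ m * (p * q))
        ≤⟨ ℕ.+-mono-≤ (mixed m (ℕ.<⇒≤ m<n)) (ℕ.≤-trans (ℕ.≤-reflexive (termˡ (P m) (P′ m) (Q m) (Q′ m) p q p′ q′))
            (ℕ.≤-trans (rearrange (P-minor m<n) (Q-minor m<n))
            (ℕ.≤-reflexive (termʳ (P m) (P′ m) (Q m) (Q′ m) p q p′ q′)))) ⟩
      (∑ m PQ′ * (p′ * q) + ∑ m P′Q * (p * q′)) + (P m * Q′ m * (p′ * q) + P′ m * Q m * (p * q′))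
        ≡⟨ regroup (∑ m PQ′) (∑ m P′Q) (Q m) (P′ m) (P m) (p′ * q) (Q′ m) (p * q′) ⟨
      (∑ m PQ′ + P m * Q′ m) * (p′ * q) + (∑ m P′Q + P′ m * Q m) * (p * q′) ∎

shift : Poly → Poly
shift p zero    = 0
shift p (suc i) = p i

-- In contrast to LogConcave, this excludes internal zeros.
StronglyLogConcave : Poly → Set
StronglyLogConcave a = ∀ {i j} → i ≤ j → a i * a (suc j) ≤ a (suc i) * a j

-- Each use of the hypothesis moves both indices of the left product inward by one. Once `i = j` the
-- two products coincide.
strongly-log-concave-gap : ∀ {a} → StronglyLogConcave a → ∀ d {i j} → i ≤ j → a i * a (d + j) ≤ a (d + i) * a j
strongly-log-concave-gap         lc zero    _   = ℕ.≤-refl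
strongly-log-concave-gap {a} lc (suc d) {i} {j} i≤j with ℕ.m≤n⇒m<n∨m≡n i≤j
... | inj₂ refl = ℕ.≤-reflexive (ℕ.*-comm (a i) (a (suc d + i)))
... | inj₁ i<j  = ℕ.≤-trans (lc (ℕ.m≤n⇒m≤o+n d i≤j))
                    (subst (λ k → a (suc i) * a (d + j) ≤ a k * a j) (ℕ.+-suc d i)
                        (strongly-log-concave-gap {a} lc d i<j))

module _ (q : Poly) where

  -- The factor `q (k − i)` of a convolution, set to 0 for `i > k`, where `q (k ∸ i)` would be
  -- `q 0`. The sums for different `k` can then be extended to a common range.
  rev : ℕ → ℕ → ℕ
  rev k       zero    = q k
  rev zero    (suc i) = 0
  rev (suc k) (suc i) = rev k i

  rev-∸ : ∀ {k i} → i ≤ k → rev k i ≡ q (k ∸ i)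
  rev-∸ {k}     {zero}  _         = refl
  rev-∸ {suc k} {suc i} (s≤s i≤k) = rev-∸ i≤k

  rev-beyond : ∀ {k i} → k < i → rev k i ≡ 0
  rev-beyond {zero}  {suc i} _         = refl
  rev-beyond {suc k} {suc i} (s≤s k<i) = rev-beyond k<i

  -- Total positivity of order 2 of the matrix with entries `q (k − i)`. For `j ≤ k` it is
  -- `strongly-log-concave-gap` with gap `l − k`; for `j > k` the left side vanishes.
  rev-minor : StronglyLogConcave q → ∀ {k l i j} → k ≤ l → i ≤ j → rev l i * rev k j ≤ rev k i * rev l j
  rev-minor lc {k} {l} {i} {j} k≤l i≤j with ℕ.≤-<-connex j k
  ... | inj₂ k<j = ℕ.≤-trans (ℕ.≤-reflexive (trans (cong (rev l i *_) (rev-beyond k<j)) (ℕ.*-zeroʳ (rev l i)))) z≤n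
  ... | inj₁ j≤k = subst₂ _≤_
      (trans (ℕ.*-comm (q (k ∸ j)) _) (cong₂ _*_ (trans (cong q (move i≤k)) (sym (rev-∸ (ℕ.≤-trans i≤k k≤l))))
          (sym (rev-∸ j≤k))))
      (trans (ℕ.*-comm _ (q (k ∸ i))) (cong₂ _*_ (sym (rev-∸ i≤k))
          (trans (cong q (move j≤k)) (sym (rev-∸ (ℕ.≤-trans j≤k k≤l))))))
      (strongly-log-concave-gap {q} lc (l ∸ k) (ℕ.∸-monoʳ-≤ k i≤j))
    where
    i≤k = ℕ.≤-trans i≤j j≤k
    move : ∀ {i} → i ≤ k → (l ∸ k) + (k ∸ i) ≡ l ∸ i
    move {i} i≤k = trans (sym (ℕ.+-∸-assoc (l ∸ k) i≤k)) (cong (_∸ i) (ℕ.m∸n+n≡m k≤l))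

module _ (p q : Poly) where

  ⊛-∑ : ∀ {k n} → k < n → (p ⊛ q) k ≡ ∑ n (λ i → p i * rev q k i)
  ⊛-∑ {k} {n} k<n = begin
    (p ⊛ q) k                        ≡⟨ ∑-upTo (suc k) _ ⟩
    ∑ (suc k) (λ i → p i * q (k ∸ i)) ≡⟨ ∑-cong (suc k) (λ { i (s≤s i≤k) → cong (p i *_) (sym (rev-∸ q i≤k)) }) ⟩
    ∑ (suc k) (λ i → p i * rev q k i) ≡⟨ ∑-extend (suc k) n _
        (λ i k<i → trans (cong (p i *_) (rev-beyond q k<i)) (ℕ.*-zeroʳ (p i))) k<n ⟨
    ∑ n (λ i → p i * rev q k i)       ∎
    where open ≡-Reasoning

  -- Shifting `p` instead of `q` expresses the coefficient at `k` through `rev q (suc k)`, the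
  -- factor that belongs to the coefficient at `suc k`. Neighbouring coefficients thus differ in one
  -- factor only.
  ⊛-∑-shift : ∀ {k n} → k < n → (p ⊛ q) k ≡ ∑ (suc n) (λ i → shift p i * rev q (suc k) i)
  ⊛-∑-shift {k} {n} k<n = trans (⊛-∑ k<n) (sym (∑-head n (λ i → shift p i * rev q (suc k) i)))

  ⊛-log-concave : StronglyLogConcave p → StronglyLogConcave q → LogConcave (p ⊛ q)
  ⊛-log-concave lcp lcq k = subst₂ _≤_
      (cong₂ _*_ (sym (⊛-∑-shift k<n)) (sym (⊛-∑ ℕ.≤-refl)))
      (cong₂ _*_ (sym (⊛-∑-shift ℕ.≤-refl)) (sym (⊛-∑ (ℕ.m<n⇒m<1+n ℕ.≤-refl))))
      -- Pairing `shift p` and `p` with `rev q` at `1 + k` and `2 + k` gives the coefficients at `k`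
      -- and `2 + k` on the left and twice the one at `1 + k` on the right.
      (binet-cauchy {shift p} {p} {rev q (suc k)} {rev q (2 + k)} (λ {i} → p-minor {i})
          (λ {i} {j} i<j → rev-minor q lcq (ℕ.n≤1+n (suc k)) (ℕ.<⇒≤ i<j)) (3 + k))
    where
    k<n : k < 2 + k
    k<n = ℕ.m<n⇒m<1+n ℕ.≤-refl
    p-minor : ∀ {i j} → i < j → shift p i * p j ≤ shift p j * p i
    p-minor {zero}          _         = z≤n
    p-minor {suc i} {suc j} (s≤s i<j) = subst (p i * p (suc j) ≤_) (ℕ.*-comm (p (suc i)) (p j)) (lcp (ℕ.<⇒≤ i<j))

-- Unimodality of a convolution

first-descent : (c : ℕ → ℕ) → ∀ n →
  (∀ i → i < n → c i ≤ c (suc i)) ⊎ (∃[ m ] (∀ i → i < m → c i ≤ c (suc i)) × c (suc m) < c m)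
first-descent c zero    = inj₁ λ _ ()
first-descent c (suc n) with first-descent c n
... | inj₂ d  = inj₂ d
... | inj₁ up with ℕ.≤-<-connex (c n) (c (suc n))
...   | inj₂ desc = inj₂ (n , up , desc)
...   | inj₁ asc  = inj₁ λ i i<1+n → step i (ℕ.m≤n⇒m<n∨m≡n (ℕ.≤-pred i<1+n))
  where
  step : ∀ i → i < n ⊎ i ≡ n → c i ≤ c (suc i)
  step i (inj₁ i<n)  = up i i<n
  step i (inj₂ refl) = asc

module _ (p q : Poly) (unimodal : Unimodal p) (lcq : StronglyLogConcave q) where

  private
    c = p ⊛ q
    m = proj₁ unimodal
    ascent descent : ℕ → ℕ
    ascent  i = p i ∸ shift p i
    descent i = shift p i ∸ p i
    U W : ℕ → ℕ → ℕ
    U n k = ∑ n (λ i → ascent i * rev q k i)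
    W n k = ∑ n (λ i → descent i * rev q k i)

  ascent-or-descent : ∀ i j → j ≤ i → ascent i * descent j ≡ 0
  ascent-or-descent i       zero    _         = trans (cong (ascent i *_) (ℕ.0∸n≡0 (p 0))) (ℕ.*-zeroʳ (ascent i))
  ascent-or-descent (suc i) (suc j) (s≤s j≤i) with ℕ.≤-<-connex m i
  ... | inj₁ m≤i = cong (_* descent (suc j)) (ℕ.m≤n⇒m∸n≡0 (proj₂ (proj₂ unimodal) i m≤i))
  ... | inj₂ i<m = trans (cong (ascent (suc i) *_) (ℕ.m≤n⇒m∸n≡0 (proj₁ (proj₂ unimodal) j (ℕ.≤-<-trans j≤i i<m))))
      (ℕ.*-zeroʳ (ascent (suc i)))

  -- In the expanded double sum a term survives only if the ascent at `i` comes before the descent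
  -- at `j`, and there `rev-minor` applies.
  U*W-mono : ∀ n {k l} → k ≤ l → U n l * W n k ≤ U n k * W n l
  U*W-mono n {k} {l} k≤l = ∑*∑-mono n term
    where
    open +-*-Solver
    regroup : ∀ a b x y → a * x * (b * y) ≡ a * b * (x * y)
    regroup = solve 4 (λ a b x y → a :* x :* (b :* y) := a :* b :* (x :* y)) refl
    term : ∀ i j → ascent i * rev q l i * (descent j * rev q k j) ≤ ascent i * rev q k i * (descent j * rev q l j)
    term i j = subst₂ _≤_ (sym (regroup (ascent i) (descent j) _ _)) (sym (regroup (ascent i) (descent j) _ _)) le
      where
      le : ascent i * descent j * (rev q l i * rev q k j) ≤ ascent i * descent j * (rev q k i * rev q l j)
      le with ℕ.≤-total j i
      ... | inj₁ j≤i rewrite ascent-or-descent i j j≤i = z≤n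
      ... | inj₂ i≤j = ℕ.*-monoʳ-≤ (ascent i * descent j) (rev-minor q lcq k≤l i≤j)

  U-W : ∀ {n k} → k < n → c (suc k) + W (suc n) (suc k) ≡ c k + U (suc n) (suc k)
  U-W {n} {k} k<n = begin
    c (suc k) + W (suc n) (suc k)
      ≡⟨ cong (_+ W (suc n) (suc k)) (⊛-∑ p q (s≤s k<n)) ⟩
    ∑ (suc n) (λ i → p i * rev q (suc k) i) + W (suc n) (suc k)
      ≡⟨ ∑-+ (suc n) _ _ ⟨
    ∑ (suc n) (λ i → p i * rev q (suc k) i + descent i * rev q (suc k) i)
      ≡⟨ ∑-cong (suc n) (λ i _ → term i (rev q (suc k) i)) ⟩
    ∑ (suc n) (λ i → shift p i * rev q (suc k) i + ascent i * rev q (suc k) i)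
      ≡⟨ ∑-+ (suc n) _ _ ⟩
    ∑ (suc n) (λ i → shift p i * rev q (suc k) i) + U (suc n) (suc k)
      ≡⟨ cong (_+ U (suc n) (suc k)) (⊛-∑-shift p q k<n) ⟨
    c k + U (suc n) (suc k) ∎
    where
    open ≡-Reasoning
    max : ∀ a b → a + (b ∸ a) ≡ b + (a ∸ b)
    max a b with ℕ.≤-total a b
    ... | inj₁ a≤b = trans (ℕ.m+[n∸m]≡n a≤b) (sym (trans (cong (b +_) (ℕ.m≤n⇒m∸n≡0 a≤b)) (ℕ.+-identityʳ b)))
    ... | inj₂ b≤a = trans (trans (cong (a +_) (ℕ.m≤n⇒m∸n≡0 b≤a)) (ℕ.+-identityʳ a)) (sym (ℕ.m+[n∸m]≡n b≤a))
    term : ∀ i x → p i * x + descent i * x ≡ shift p i * x + ascent i * x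
    term i x = trans (sym (ℕ.*-distribʳ-+ x (p i) _))
        (trans (cong (_* x) (max (p i) (shift p i))) (ℕ.*-distribʳ-+ x (shift p i) _))

  -- c_{k+1} − c_k = U_{k+1} − W_{k+1}, and the ratio U / W is decreasing, so
  -- that c never rises again after its first strict descent.
  descent-persists : ∀ {k} → c (suc k) < c k → ∀ l → k ≤ l → c (suc l) ≤ c l
  descent-persists {k} desc l k≤l = ℕ.+-cancelʳ-≤ (W n (suc l)) (c (suc l)) (c l)
      (ℕ.≤-trans (ℕ.≤-reflexive (U-W ℕ.≤-refl)) (ℕ.+-monoʳ-≤ (c l) U≤W))
    where
    n = 2 + l
    U<W : U n (suc k) < W n (suc k)
    U<W = ℕ.+-cancelˡ-< (c k) _ _ (subst (_< c k + W n (suc k)) (U-W (s≤s k≤l)) (ℕ.+-monoˡ-< (W n (suc k)) desc))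
    -- With `k′ = suc k` and `l′ = suc l`: `U l′ * W k′ ≤ U k′ * W l′ ≤ W k′ * W l′`, and the factor
    -- `W k′` exceeds `U k′`, so it is positive and cancels.
    U≤W : U n (suc l) ≤ W n (suc l)
    U≤W = ℕ.*-cancelʳ-≤ _ _ (W n (suc k)) ⦃ >-nonZero (ℕ.≤-<-trans z≤n U<W) ⦄
      (ℕ.≤-trans (U*W-mono n (s≤s k≤l)) (subst (U n (suc k) * W n (suc l) ≤_) (ℕ.*-comm (W n (suc k)) _)
          (ℕ.*-monoˡ-≤ (W n (suc l)) (ℕ.<⇒≤ U<W))))

  -- The peak is the first strict descent before `n`. If there is none, the sequence rises up to
  -- `n`, from where on it is zero.
  ⊛-unimodal : ∀ n → (∀ k → n ≤ k → c k ≡ 0) → Unimodal c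
  ⊛-unimodal n vanishes with first-descent c n
  ... | inj₁ up               = n , up , λ i n≤i → subst (_≤ c i) (sym (vanishes (suc i) (ℕ.m≤n⇒m≤1+n n≤i))) z≤n
  ... | inj₂ (k , up , desc)  = k , up , descent-persists desc

-- Multiply the case `d` by log-concavity at `d + i` and cancel the inner entries `x` and `y`. They
-- are positive for lack of gaps, unless an outer entry is zero and the claim is trivial.
log-concave⇒strong : ∀ {a} → LogConcave a → (∀ {i j k} → i < j → j < k → 0 < a i → 0 < a k → 0 < a j) →
    StronglyLogConcave a
log-concave⇒strong {a} lc no-gap {i} {j} i≤j = subst (λ j → a i * a (suc j) ≤ a (suc i) * a j) (ℕ.m∸n+n≡m i≤j)
    (go (j ∸ i))
  where
  open ℕ.≤-Reasoning
  open +-*-Solver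
  go : ∀ d → a i * a (suc d + i) ≤ a (suc i) * a (d + i)
  go zero    = ℕ.≤-reflexive (ℕ.*-comm (a i) (a (suc i)))
  go (suc d) with ℕ.m≤n⇒m<n∨m≡n (z≤n {a i}) | ℕ.m≤n⇒m<n∨m≡n (z≤n {a (2 + d + i)})
  ... | inj₂ z | _ rewrite sym z = z≤n
  ... | inj₁ _ | inj₂ z rewrite sym z | ℕ.*-zeroʳ (a i) = z≤n
  ... | inj₁ aᵢ>0 | inj₁ aₖ>0 = ℕ.*-cancelʳ-≤ _ _ (x * y) ⦃ ℕ.m*n≢0 x y ⦃ >-nonZero x>0 ⦄ ⦃ >-nonZero y>0 ⦄ ⦄ (begin
      a i * z * (x * y)         ≡⟨ solve 4 (λ a z x y → a :* z :* (x :* y) := a :* y :* (x :* z)) refl (a i) z x y ⟩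
      a i * y * (x * z)         ≤⟨ ℕ.*-mono-≤ (go d) (lc (d + i)) ⟩
      a (suc i) * x * (y * y)   ≡⟨ solve 3 (λ b x y → b :* x :* (y :* y) := b :* y :* (x :* y)) refl (a (suc i)) x y ⟩
      a (suc i) * y * (x * y)   ∎)
    where
    x = a (d + i)
    y = a (suc d + i)
    z = a (2 + d + i)
    inner : ∀ e → suc e < 2 + d → 0 < a (suc e + i)
    inner e lt = no-gap (s≤s (ℕ.m≤n+m i e)) (ℕ.+-monoˡ-< i lt) aᵢ>0 aₖ>0
    y>0 : 0 < y
    y>0 = inner d ℕ.≤-refl
    x>0 : 0 < x
    x>0 = x-pos d refl
      where
      -- For `d = 0` the factor `x` is the outer entry `a i` itself.
      x-pos : ∀ e → e ≡ d → 0 < a (e + i)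
      x-pos zero    _    = aᵢ>0
      x-pos (suc e) refl = inner e (ℕ.m<n⇒m<1+n ℕ.≤-refl)

-- The polynomials of the ladder surfaces

δ : Poly
δ zero    = 1
δ (suc _) = 0

data Kind : Set where
  apart joined : Kind

-- The two corners at which the ends of the next letter may be attached are
-- either different vertices of the surface or the same one.
pieces : Kind → ℕ → Poly
pieces κ      zero    g = δ g
pieces apart  (suc m) g = 2 * pieces apart m g + 2 * shift (pieces joined m) g
pieces joined (suc m) g = 4 * pieces apart m g

private
  -- Expanding the strong property of 2a + 2xb gives four products. `rising` and `falling` bound the
  -- two mixed ones; their offsets differ because b enters shifted by one genus.
  record Interlaced (a b : Poly) : Set where
    field
      strongˡ : StronglyLogConcave a
      strongʳ : StronglyLogConcave b
      rising  : ∀ {i j} → i ≤ j → a i * b (suc j) ≤ a (suc i) * b j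
      falling : ∀ {i j} → i ≤ j → b i * a (2 + j) ≤ b (suc i) * a (suc j)

  interlaced : ∀ m → Interlaced (pieces apart m) (pieces joined m)
  interlaced zero = record
    { strongˡ = λ {i} _ → vanish i ; strongʳ = λ {i} _ → vanish i ; rising = λ {i} _ → vanish i ; falling = λ {i} _
        → vanish i }
    where
    vanish : ∀ i {k} → δ i * 0 ≤ k
    vanish i rewrite ℕ.*-zeroʳ (δ i) = z≤n
  interlaced (suc m) = record
    { strongˡ = λ i≤j → strong (ℕ.m≤n⇒m<n∨m≡n i≤j)
    ; strongʳ = λ {i} {j} i≤j → quadruple (a i) (a (suc j)) (a (suc i)) (a j) (strongˡ i≤j)
    ; rising  = λ {i} {j} i≤j → scale₁ (a i) (shift b i) (a (suc i)) (b i) (strongˡ i≤j) (fall i≤j)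
    ; falling = λ {i} {j} i≤j → scale₂ (a (2 + j)) (b (suc j)) (a (suc j)) (b j) {a i} {a (suc i)}
        (strongˡ (ℕ.m≤n⇒m≤1+n i≤j)) (rising i≤j)
    }
    where
    open Interlaced (interlaced m)
    open ℕ.≤-Reasoning
    open +-*-Solver
    a = pieces apart m
    b = pieces joined m
    strong-shift : ∀ {i j} → i ≤ j → shift b i * b j ≤ b i * shift b j
    strong-shift {zero}          _         = z≤n
    strong-shift {suc i} {suc j} (s≤s i≤j) = strongʳ i≤j
    rise : ∀ {i j} → i < j → a i * b j ≤ a (suc i) * shift b j
    rise {i} {suc j} (s≤s i≤j) = rising i≤j
    fall : ∀ {i j} → i ≤ j → shift b i * a (suc j) ≤ b i * a j
    fall {zero}          _         = z≤n
    fall {suc i} {suc j} (s≤s i≤j) = falling i≤j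
    a′ : Poly
    a′ = pieces apart (suc m)
    expand : ∀ x y z w → (2 * x + 2 * y) * (2 * z + 2 * w) ≡ 4 * (x * z + x * w + (y * z + y * w))
    expand = solve 4 (λ x y z w → (con 2 :* x :+ con 2 :* y) :* (con 2 :* z :+ con 2 :* w) := con 4 :*
        (x :* z :+ x :* w :+ (y :* z :+ y :* w))) refl
    strong : ∀ {i j} → i < j ⊎ i ≡ j → a′ i * a′ (suc j) ≤ a′ (suc i) * a′ j
    -- The diagonal is treated apart, since `rise` needs `i < j`.
    strong {i}     (inj₂ refl) = ℕ.≤-reflexive (ℕ.*-comm (a′ i) (a′ (suc i)))
    strong {i} {j} (inj₁ i<j)  = begin
      a′ i * a′ (suc j) ≡⟨ expand (a i) (shift b i) (a (suc j)) (b j) ⟩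
      4 * (a i * a (suc j) + a i * b j + (shift b i * a (suc j) + shift b i * b j))
        ≤⟨ ℕ.*-monoʳ-≤ 4 (ℕ.+-mono-≤ (ℕ.+-mono-≤ (strongˡ i≤j) (rise i<j)) (ℕ.+-mono-≤ (fall i≤j) (strong-shift i≤j))) ⟩
      4 * (a (suc i) * a j + a (suc i) * shift b j + (b i * a j + b i * shift b j))
        ≡⟨ expand (a (suc i)) (b i) (a j) (shift b j) ⟨
      a′ (suc i) * a′ j ∎
      where i≤j = ℕ.<⇒≤ i<j
    quadruple : ∀ x y z w → x * y ≤ z * w → 4 * x * (4 * y) ≤ 4 * z * (4 * w)
    quadruple x y z w le = subst₂ _≤_ (sym (e x y)) (sym (e z w)) (ℕ.*-monoʳ-≤ 16 le)
      where
      e : ∀ x y → 4 * x * (4 * y) ≡ 16 * (x * y)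
      e = solve 2 (λ x y → con 4 :* x :* (con 4 :* y) := con 16 :* (x :* y)) refl
    scale₁ : ∀ x y z w {u v} → x * u ≤ z * v → y * u ≤ w * v → (2 * x + 2 * y) * (4 * u) ≤ (2 * z + 2 * w) * (4 * v)
    scale₁ x y z w {u} {v} le le′ = subst₂ _≤_ (sym (e x y u)) (sym (e z w v)) (ℕ.*-monoʳ-≤ 8 (ℕ.+-mono-≤ le le′))
      where
      e : ∀ x y u → (2 * x + 2 * y) * (4 * u) ≡ 8 * (x * u + y * u)
      e = solve 3 (λ x y u → (con 2 :* x :+ con 2 :* y) :* (con 4 :* u) := con 8 :* (x :* u :+ y :* u)) refl
    scale₂ : ∀ x y z w {u v} → u * x ≤ v * z → u * y ≤ v * w → 4 * u * (2 * x + 2 * y) ≤ 4 * v * (2 * z + 2 * w)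
    scale₂ x y z w {u} {v} le le′ = subst₂ _≤_ (sym (e x y u)) (sym (e z w v)) (ℕ.*-monoʳ-≤ 8 (ℕ.+-mono-≤ le le′))
      where
      e : ∀ x y u → 4 * u * (2 * x + 2 * y) ≡ 8 * (u * x + u * y)
      e = solve 3 (λ x y u → con 4 :* u :* (con 2 :* x :+ con 2 :* y) := con 8 :* (u :* x :+ u :* y)) refl

pieces-strong : ∀ κ m → StronglyLogConcave (pieces κ m)
pieces-strong apart  m = Interlaced.strongˡ (interlaced m)
pieces-strong joined m = Interlaced.strongʳ (interlaced m)

-- Sums over pairs of subsets

private
  variable
    m N : ℕ

indicator : {P : Set} → Dec P → ℕ
indicator (yes _) = 1
indicator (no  _) = 0

length-filter : {P : A → Set} (P? : ∀ x → Dec (P x)) → ∀ xs → length (filter P? xs) ≡ ℕ.sum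
    (map (λ x → indicator (P? x)) xs)
length-filter P? []       = refl
length-filter P? (x ∷ xs) with P? x
... | yes _ = cong suc (length-filter P? xs)
... | no  _ = length-filter P? xs

sum-map-++ : (f : A → ℕ) → ∀ xs ys → ℕ.sum (map f (xs ++ ys)) ≡ ℕ.sum (map f xs) + ℕ.sum (map f ys)
sum-map-++ f xs ys = trans (cong ℕ.sum (List.map-++ f xs ys)) (ℕ.sum-++ (map f xs) (map f ys))

sum-map-∘ : (f : B → ℕ) (g : A → B) → ∀ xs → ℕ.sum (map f (map g xs)) ≡ ℕ.sum (map (f ∘ g) xs)
sum-map-∘ f g xs = cong ℕ.sum (sym (List.map-∘ {g = f} {f = g} xs))

sum-product : {C : Set} (h : C → ℕ) (f : A → B → C) → ∀ xs ys →
  ℕ.sum (map h (cartesianProductWith f xs ys)) ≡ ℕ.sum (map (λ x → ℕ.sum (map (λ y → h (f x y)) ys)) xs)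
sum-product h f []       ys = refl
sum-product h f (x ∷ xs) ys = trans (sum-map-++ h (map (f x) ys) _)
    (cong₂ _+_ (sum-map-∘ h (f x) ys) (sum-product h f xs ys))

∑⊆ : ∀ n → (Subset n → ℕ) → ℕ
∑⊆ zero    h = h []ᵛ
∑⊆ (suc n) h = ∑⊆ n (λ K → h (inside ∷ᵛ K)) + ∑⊆ n (λ K → h (outside ∷ᵛ K))

∑⊆-cong : ∀ n {f g} → f ≗ g → ∑⊆ n f ≡ ∑⊆ n g
∑⊆-cong zero    eq = eq []ᵛ
∑⊆-cong (suc n) eq = cong₂ _+_ (∑⊆-cong n λ K → eq (inside ∷ᵛ K)) (∑⊆-cong n λ K → eq (outside ∷ᵛ K))

∑⊆-+ : ∀ n f g → ∑⊆ n (λ K → f K + g K) ≡ ∑⊆ n f + ∑⊆ n g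
∑⊆-+ zero    f g = refl
∑⊆-+ (suc n) f g = trans (cong₂ _+_ (∑⊆-+ n _ _) (∑⊆-+ n _ _))
    (solve 4 (λ a b c d → (a :+ b) :+ (c :+ d) := (a :+ c) :+ (b :+ d)) refl (∑⊆ n (λ K → f (inside ∷ᵛ K)))
    (∑⊆ n (λ K → g (inside ∷ᵛ K))) (∑⊆ n (λ K → f (outside ∷ᵛ K))) (∑⊆ n (λ K → g (outside ∷ᵛ K))))
  where open +-*-Solver

sum-subsets : ∀ n (h : Subset n → ℕ) → ℕ.sum (map h (subsets n)) ≡ ∑⊆ n h
sum-subsets zero    h = ℕ.+-identityʳ (h []ᵛ)
sum-subsets (suc n) h = begin
  ℕ.sum (map h (subsets (suc n)))  ≡⟨ sum-product h _∷ᵛ_ (inside ∷ outside ∷ []) (subsets n) ⟩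
  ℕ.sum (map (λ K → h (inside ∷ᵛ K)) (subsets n)) + (ℕ.sum (map (λ K → h (outside ∷ᵛ K)) (subsets n)) + 0)
    ≡⟨ cong₂ _+_ (sum-subsets n _) (trans (ℕ.+-identityʳ _) (sum-subsets n _)) ⟩
  ∑⊆ (suc n) h ∎
  where open ≡-Reasoning

total : (m : ℕ) → (Subset m → Subset m → Word N) → Poly
total m W g = ∑⊆ m λ K → ∑⊆ m λ T → indicator (wordHasGenus? g (W K T))

surfacePoly-total : ∀ n S g → surfacePoly n S g ≡ total n S g
surfacePoly-total n S g = begin
  length (filter (wordHasGenus? g) (surfaces n S))                   ≡⟨ length-filter (wordHasGenus? g) (surfaces n S) ⟩
  ℕ.sum (map (λ w → indicator (wordHasGenus? g w)) (surfaces n S))   ≡⟨ sum-product _ S (subsets n) (subsets n) ⟩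
  ℕ.sum (map (λ K → ℕ.sum (map (λ T → indicator (wordHasGenus? g (S K T))) (subsets n))) (subsets n))
      ≡⟨ sum-subsets n _ ⟩
  ∑⊆ n (λ K → ℕ.sum (map (λ T → indicator (wordHasGenus? g (S K T))) (subsets n)))
      ≡⟨ ∑⊆-cong n (λ K → sum-subsets n _) ⟩
  total n S g ∎
  where open ≡-Reasoning

total-cong : {W W′ : Subset m → Subset m → Word N} → (∀ K T → W K T ≡ W′ K T) → total m W ≗ total m W′
total-cong {m} eq g = ∑⊆-cong m λ K → ∑⊆-cong m λ T → cong (λ w → indicator (wordHasGenus? g w)) (eq K T)

-- The recursion of `pieces` for a family of words with `m` letters still to be placed and genus `g`
-- reached so far. The head bits of `K` and `T` place the next letter; from `apart`, opposite bits
-- keep the genus and equal ones raise it.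
data Behaves {N : ℕ} : Kind → (m : ℕ) → ℕ → (Subset m → Subset m → Word N) → Set where
  done   : ∀ {κ g W} → WordHasGenus g (W []ᵛ []ᵛ) → Behaves κ zero g W
  apart  : ∀ {m g W} →
           (∀ k → Behaves apart  m g       (λ K T → W (k ∷ᵛ K) (not k ∷ᵛ T))) →
           (∀ k → Behaves joined m (suc g) (λ K T → W (k ∷ᵛ K) (k ∷ᵛ T))) →
           Behaves apart (suc m) g W
  joined : ∀ {m g W} →
           (∀ k t → Behaves apart m g (λ K T → W (k ∷ᵛ K) (t ∷ᵛ T))) →
           Behaves joined (suc m) g W

shiftBy : ℕ → Poly → Poly
shiftBy zero    p = p
shiftBy (suc d) p = shift (shiftBy d p)

shiftBy-δ : ∀ {d} (w : Word N) → WordHasGenus d w → ∀ g → indicator (wordHasGenus? g w) ≡ shiftBy d δ g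
shiftBy-δ {d = d} w genus g with wordHasGenus? g w
... | yes genus′ rewrite ℕ.*-cancelˡ-≡ g d 2 (ℕ.+-cancelˡ-≡ (vertices w) _ _ (trans genus′ (sym genus))) = one d
  where
  one : ∀ d → 1 ≡ shiftBy d δ d
  one zero    = refl
  one (suc d) = one d
... | no ¬genus = none d g λ { refl → ¬genus genus }
  where
  none : ∀ d g → g ≢ d → 0 ≡ shiftBy d δ g
  none zero    zero    g≢d = contradiction refl g≢d
  none zero    (suc g) g≢d = refl
  none (suc d) zero    g≢d = refl
  none (suc d) (suc g) g≢d = none d g (g≢d ∘ cong suc)

shiftBy-apart : ∀ m d g → shiftBy d (pieces apart (suc m)) g ≡ 2 * shiftBy d (pieces apart m) g + 2 * shiftBy
    (suc d) (pieces joined m) g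
shiftBy-apart m zero    g       = refl
shiftBy-apart m (suc d) zero    = refl
shiftBy-apart m (suc d) (suc g) = shiftBy-apart m d g

shiftBy-joined : ∀ m d g → shiftBy d (pieces joined (suc m)) g ≡ 4 * shiftBy d (pieces apart m) g
shiftBy-joined m zero    g       = refl
shiftBy-joined m (suc d) zero    = refl
shiftBy-joined m (suc d) (suc g) = shiftBy-joined m d g

total-suc : (W : Subset (suc m) → Subset (suc m) → Word N) → ∀ g →
  let t = λ k l → total m (λ K T → W (k ∷ᵛ K) (l ∷ᵛ T)) g in
  total (suc m) W g ≡ t inside inside + t inside outside + (t outside inside + t outside outside)
total-suc {m} W g = cong₂ _+_ (∑⊆-+ m _ _) (∑⊆-+ m _ _)

behaves-total : ∀ {κ d} {W : Subset m → Subset m → Word N} → Behaves κ m d W → total m W ≗ shiftBy d (pieces κ m)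
behaves-total {d = d} {W = W} (done genus) g = shiftBy-δ {d = d} (W []ᵛ []ᵛ) genus g
behaves-total {m = suc m} {d = d} {W = W} (apart a j) g = begin
  total (suc m) W g                         ≡⟨ total-suc W g ⟩
  _                                         ≡⟨ cong₂ _+_
      (cong₂ _+_ (behaves-total (j true) g) (behaves-total (a true) g))
      (cong₂ _+_ (behaves-total (a false) g) (behaves-total (j false) g)) ⟩
  _                                         ≡⟨ solve 2 (λ x y → (y :+ x) :+ (x :+ y) := con 2 :* x :+ con 2 :* y)
      refl (shiftBy d (pieces apart m) g) (shiftBy (suc d) (pieces joined m) g) ⟩
  _                                         ≡⟨ shiftBy-apart m d g ⟨
  shiftBy d (pieces apart (suc m)) g        ∎
  where
  open ≡-Reasoning
  open +-*-Solver
behaves-total {m = suc m} {d = d} {W = W} (joined a) g = begin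
  total (suc m) W g                         ≡⟨ total-suc W g ⟩
  _                                         ≡⟨ cong₂ _+_
      (cong₂ _+_ (behaves-total (a true true) g) (behaves-total (a true false) g))
      (cong₂ _+_ (behaves-total (a false true) g) (behaves-total (a false false) g)) ⟩
  _                                         ≡⟨ solve 1 (λ x → (x :+ x) :+ (x :+ x) := con 4 :* x) refl
      (shiftBy d (pieces apart m) g) ⟩
  _                                         ≡⟨ shiftBy-joined m d g ⟨
  shiftBy d (pieces joined (suc m)) g       ∎
  where
  open ≡-Reasoning
  open +-*-Solver

-- Attaching a letter to a surface

Unique-↭ : {xs ys : List A} → xs ↭ ys → Unique xs → Unique ys
Unique-↭ p = PermSetoid.Unique-resp-↭ (setoid _) (↭⇒↭ₛ p)

module _ {N : ℕ} where

  open Orbits (_≟ˢ_ {N})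

  private
    variable
      e h v x y : Side N
      w zs : Word N

  -- The side following x in the linear word, where e follows its last side.
  following : Side N → Word N → Side N → Side N
  following e []       x = x
  following e (y ∷ ys) x with x ≟ˢ y | ys
  ... | no  _ | _     = following e ys x
  ... | yes _ | []    = e
  ... | yes _ | z ∷ _ = z

  -- `next` scans the word with a local function. `following` reproduces that scan with the
  -- wrap-around target as a parameter, which makes induction on the word possible.
  next-tail : ∀ zs → x ≢ h → next (h ∷ zs) x ≡ following h zs x
  next-tail {x} {h} [] x≢h with x ≟ˢ h
  ... | yes x≡h = contradiction x≡h x≢h
  ... | no  _   = refl
  next-tail {x} {h} (y ∷ zs) x≢h with next-tail {x} {h} zs x≢h
  ... | ih with x ≟ˢ h
  ...   | yes x≡h = contradiction x≡h x≢h
  ...   | no  _ with x ≟ˢ y | zs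
  ...     | no  _ | _     = ih
  ...     | yes _ | []    = refl
  ...     | yes _ | z ∷ _ = refl

  next-head : ∀ (x y : Side N) zs → next (x ∷ y ∷ zs) x ≡ y
  next-head x _ _ with x ≟ˢ x
  ... | yes _  = refl
  ... | no x≢x = contradiction refl x≢x

  next-single : next (h ∷ []) x ≡ x
  next-single {h} {x} with x ≟ˢ h
  ... | yes refl = refl
  ... | no  _    = refl

  following-∉ : ∀ zs → x ∉ zs → following e zs x ≡ x
  following-∉         []       _    = refl
  following-∉ {x} (z ∷ zs) x∉zs with x ≟ˢ z | zs
  ... | yes x≡z | _      = contradiction (here x≡z) x∉zs
  ... | no  _   | zs     = following-∉ zs (x∉zs ∘ there)

  next-∉ : x ∉ w → next w x ≡ x
  next-∉ {w = []}     _   = refl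
  next-∉ {w = h ∷ zs} x∉w = trans (next-tail zs (x∉w ∘ here)) (following-∉ zs (x∉w ∘ there))

  following-snoc-≢ : ∀ zs → x ≢ v → following e (zs ++ [ v ]) x ≡ following v zs x
  following-snoc-≢ {x} {v} [] x≢v with x ≟ˢ v
  ... | yes x≡v = contradiction x≡v x≢v
  ... | no  _   = refl
  following-snoc-≢ {x} (z ∷ zs) x≢v with following-snoc-≢ zs x≢v
  ... | ih with x ≟ˢ z | zs
  ...   | no  _ | _     = ih
  ...   | yes _ | []    = refl
  ...   | yes _ | _ ∷ _ = refl

  following-snoc : ∀ zs → v ∉ zs → following e (zs ++ [ v ]) v ≡ e
  following-snoc {v} [] _ with v ≟ˢ v
  ... | yes _  = refl
  ... | no v≢v = contradiction refl v≢v
  following-snoc {v} (z ∷ zs) v∉zs with following-snoc zs (v∉zs ∘ there)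
  ... | ih with v ≟ˢ z
  ...   | no  _   = ih
  ...   | yes v≡z = contradiction (here v≡z) v∉zs

  next-rotate₁ : ∀ v us → v ∉ us → next (v ∷ us) ≗ next (us ++ [ v ])
  next-rotate₁ v []       _    x = refl
  next-rotate₁ v (u ∷ us) v∉us x = cases (x ≟ˢ v) (x ≟ˢ u)
    where
    head : ∀ us → following v (u ∷ us) u ≡ next (u ∷ us ++ [ v ]) u
    head us with u ≟ˢ u | us
    ... | yes _  | []    = refl
    ... | yes _  | _ ∷ _ = refl
    ... | no u≢u | _     = contradiction refl u≢u
    skip : x ≢ u → following v (u ∷ us) x ≡ following v us x
    skip x≢u with x ≟ˢ u
    ... | yes x≡u = contradiction x≡u x≢u
    ... | no  _   = refl
    cases : Dec (x ≡ v) → Dec (x ≡ u) → next (v ∷ u ∷ us) x ≡ next (u ∷ us ++ [ v ]) x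
    cases (yes refl) (yes refl) = contradiction (here refl) v∉us
    cases (yes refl) (no x≢u)   = trans (next-head v u us)
        (sym (trans (next-tail (us ++ [ v ]) x≢u) (following-snoc us (v∉us ∘ there))))
    cases (no x≢v)   (yes refl) = trans (next-tail (u ∷ us) x≢v) (head us)
    cases (no x≢v)   (no x≢u)   = trans (next-tail (u ∷ us) x≢v)
        (trans (skip x≢u) (sym (trans (next-tail (us ++ [ v ]) x≢u) (following-snoc-≢ us x≢v))))

  -- Uniqueness matters because `next` stops at the first occurrence of a side, and a rotation could
  -- change which one is first.
  next-rotate : ∀ us vs → Unique (us ++ vs) → next (us ++ vs) ≗ next (vs ++ us)
  next-rotate []       vs unique x = cong (λ w → next w x) (sym (List.++-identityʳ vs))
  next-rotate (u ∷ us) vs unique@(u∉ ∷ _) x = begin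
    next (u ∷ us ++ vs) x        ≡⟨ next-rotate₁ u (us ++ vs) (λ m → All.lookup u∉ m refl) x ⟩
    next ((us ++ vs) ++ [ u ]) x ≡⟨ cong (λ w → next w x) (List.++-assoc us vs [ u ]) ⟩
    next (us ++ vs ++ [ u ]) x   ≡⟨ next-rotate us (vs ++ [ u ])
        (subst Unique (List.++-assoc us vs [ u ]) (Unique-↭ (Perm.++-comm [ u ] (us ++ vs)) unique)) x ⟩
    next ((vs ++ [ u ]) ++ us) x ≡⟨ cong (λ w → next w x) (List.++-assoc vs [ u ] us) ⟩
    next (vs ++ u ∷ us) x        ∎
    where open ≡-Reasoning

  following-swap : ∀ zs → x ≢ v → x ≢ y → v ∉ zs → y ∉ zs → following y zs x ≡ swap v y (following v zs x)
  following-swap [] x≢v x≢y _ _ = sym (swap-other x≢v x≢y)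
  following-swap {x} {v} {y} (z ∷ zs) x≢v x≢y v∉zs y∉zs with following-swap zs x≢v x≢y (v∉zs ∘ there) (y∉zs ∘ there)
  ... | ih with x ≟ˢ z | zs
  ...   | no  _ | _      = ih
  ...   | yes _ | []     = sym (swap-left v y)
  ...   | yes _ | z′ ∷ _ = sym (swap-other (λ { refl → v∉zs (there (here refl)) })
      (λ { refl → y∉zs (there (here refl)) }))

  -- The side that led to `h` now leads to `y`, and `y`, a fixed point of `next` while absent, now
  -- leads to `h`. The change is a transposition because `next` fixes absent sides.
  next-insert-head : ∀ {vs} → Unique (h ∷ vs) → y ∉ h ∷ vs → next (y ∷ h ∷ vs) ≗ swap h y ∘ next (h ∷ vs)
  next-insert-head {h} {y} {vs} (h∉ ∷ _) y∉ x = cases (x ≟ˢ y) (x ≟ˢ h)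
    where
    at-head : ∀ vs → All (h ≢_) vs → y ∉ h ∷ vs → following y (h ∷ vs) h ≡ swap h y (next (h ∷ vs) h)
    at-head []      _  _  with h ≟ˢ h
    ... | yes _  = sym (swap-left h y)
    ... | no h≢h = contradiction refl h≢h
    at-head (z ∷ _) (h≢z ∷ _) y∉ with h ≟ˢ h
    ... | yes _  = sym (swap-other (h≢z ∘ sym) (λ z≡y → y∉ (there (here (sym z≡y)))))
    ... | no h≢h = contradiction refl h≢h
    skip : x ≢ h → following y (h ∷ vs) x ≡ following y vs x
    skip x≢h with x ≟ˢ h
    ... | yes x≡h = contradiction x≡h x≢h
    ... | no  _   = refl
    cases : Dec (x ≡ y) → Dec (x ≡ h) → next (y ∷ h ∷ vs) x ≡ swap h y (next (h ∷ vs) x)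
    cases (yes refl) _          = trans (next-head y h vs) (sym (trans (cong (swap h y) (next-∉ y∉)) (swap-right h y)))
    cases (no x≢y)   (yes refl) = trans (next-tail (h ∷ vs) x≢y) (at-head vs h∉ y∉)
    cases (no x≢y)   (no x≢h)   = trans (next-tail (h ∷ vs) x≢y)
        (trans (skip x≢h) (trans (following-swap vs x≢h x≢y (λ m → All.lookup h∉ m refl) (y∉ ∘ there))
        (cong (swap h y) (sym (next-tail vs x≢h)))))

  -- y is inserted into the cyclic word w at the corner where the side h starts.
  record Inserted (h y : Side N) (w w′ : Word N) : Set where
    constructor inserted
    field
      us vs {rest} : Word N
      before : w ≡ us ++ vs
      after  : w′ ≡ us ++ y ∷ vs
      corner : vs ++ us ≡ h ∷ rest

  inserted-↭ : ∀ {w′} → Inserted h y w w′ → w′ ↭ y ∷ w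
  inserted-↭ {y = y} (inserted us vs refl refl _) = Perm.shift y us vs

  corner-∈ : ∀ {w′} → Inserted h y w w′ → h ∈ w
  corner-∈ {h} (inserted us vs refl refl c) = Perm.∈-resp-↭ (Perm.++-comm vs us) (subst (h ∈_) (sym c) (here refl))

  inserted-unique : ∀ {w′} → Inserted h y w w′ → y ∉ w → Unique w → Unique w′
  inserted-unique ins y∉w unique = Unique-↭ (↭-sym (inserted-↭ ins)) (All.tabulate (λ { m refl → y∉w m }) ∷ unique)

  next-inserted : ∀ {w′} → Inserted h y w w′ → y ∉ w → Unique w → next w′ ≗ swap h y ∘ next w
  next-inserted {h} {y} ins@(inserted us vs {rest} refl refl c) y∉w unique x = begin
    next (us ++ y ∷ vs) x        ≡⟨ next-rotate us (y ∷ vs) (inserted-unique ins y∉w unique) x ⟩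
    next (y ∷ vs ++ us) x        ≡⟨ cong (λ w → next (y ∷ w) x) c ⟩
    next (y ∷ h ∷ rest) x        ≡⟨ next-insert-head rotated
        (y∉w ∘ Perm.∈-resp-↭ (Perm.++-comm vs us) ∘ subst (y ∈_) (sym c)) x ⟩
    swap h y (next (h ∷ rest) x) ≡⟨ cong (λ w → swap h y (next w x)) c ⟨
    swap h y (next (vs ++ us) x) ≡⟨ cong (swap h y) (next-rotate us vs unique x) ⟨
    swap h y (next (us ++ vs) x) ∎
    where
    open ≡-Reasoning
    rotated : Unique (h ∷ rest)
    rotated = subst Unique c (Unique-↭ (Perm.++-comm us vs) unique)

-- The surfaces arising when the letters are attached one after the other

module _ {N : ℕ} where

  open Orbits (_≟ˢ_ {N})

  sides : List (Side N)
  sides = cartesianProduct (nothing ∷ map just (allFin N)) (Sign.+ ∷ Sign.- ∷ [])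

  ∈-sides : ∀ x → x ∈ sides
  ∈-sides (l , s) = Mem.∈-cartesianProduct⁺ (∈-letters l) (∈-signs s)
    where
    ∈-letters : ∀ l → l ∈ nothing ∷ map just (allFin N)
    ∈-letters nothing  = here refl
    ∈-letters (just i) = there (Mem.∈-map⁺ just (Mem.∈-allFin i))
    ∈-signs : ∀ s → s ∈ Sign.+ ∷ Sign.- ∷ []
    ∈-signs Sign.+ = here refl
    ∈-signs Sign.- = there (here refl)

  open Finite sides ∈-sides

  inverse-involutive : ∀ (x : Side N) → inverse (inverse x) ≡ x
  inverse-involutive (l , Sign.+) = refl
  inverse-involutive (l , Sign.-) = refl

  inverse-≢ : ∀ (x : Side N) → x ≢ inverse x
  inverse-≢ (l , Sign.+) ()
  inverse-≢ (l , Sign.-) ()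

  inverse-injective : Injective _≡_ _≡_ (inverse {N})
  inverse-injective {x} {y} eq = trans (sym (inverse-involutive x)) (trans (cong inverse eq) (inverse-involutive y))

  -- L lists the letters that do not occur in w, whose two sides form an orbit of f.
  record WordState (L : List (Letter N)) (w : Word N) (f : Side N → Side N) : Set where
    field
      corners   : ∀ x → next w (inverse x) ≡ f x
      injective : Injective _≡_ _≡_ f
      unique    : Unique w
      missing   : Unique L
      fresh     : ∀ {x} → x ∈ w → proj₁ x ∉ L
      covers    : ∀ x → x ∈ w ⊎ proj₁ x ∈ L

    on-missing : ∀ {x} → proj₁ x ∈ L → f x ≡ inverse x
    on-missing {x} l∈L = trans (sym (corners x)) (next-∉ {w = w} λ m → fresh m l∈L)

    missing-closed : ∀ {l} → l ∈ L → ∀ {x} → proj₁ x ≡ l → proj₁ (f x) ≡ l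
    missing-closed l∈L {x} refl = cong proj₁ (on-missing {x} l∈L)

    closed : ∀ {x} → x ∈ w → f x ∈ w
    closed {x} x∈w with covers (f x)
    ... | inj₁ fx∈w = fx∈w
    ... | inj₂ l∈L  = contradiction (subst (λ y → proj₁ y ∈ L) back l∈L) (fresh x∈w)
      where
      back : inverse (f x) ≡ x
      back = injective (trans (on-missing {inverse (f x)} l∈L) (inverse-involutive (f x)))

    -- Representatives are one side of each missing letter and those that `vertices` finds in `w`.
    -- The two kinds never meet, since `f` keeps the sides of a missing letter among themselves.
    count-vertices : count f ≡ length L + vertices w
    count-vertices = begin
      count f                                        ≡⟨ transversal-count injective (transversal cover indep) ⟨
      length (map (λ l → pos l) L ++ ts)                        ≡⟨ List.length-++ (map (λ l → pos l) L) ⟩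
      length (map (λ l → pos l) L) + length ts
          ≡⟨ cong (_+ length ts) (List.length-map (λ l → pos l) L) ⟩
      length L + vertices w                          ∎
      where
      open ≡-Reasoning
      R? = inOrbit? _≟ˢ_ (λ x → next w (inverse x)) w
      ts = deduplicate R? w
      sound : ∀ {x y} → InOrbit _≟ˢ_ (λ x → next w (inverse x)) w x y → Reach f x y
      sound r = reach-cong corners (inOrbit⇒reach _ w r)
      ts⊆w : ∀ {t} → t ∈ ts → t ∈ w
      ts⊆w = Mem.∈-deduplicate⁻ R? w
      same-letter : ∀ {l x} → l ∈ L → Reach f (pos l) x → proj₁ x ≡ l
      same-letter {l} l∈L r = reach-inv {P = λ x → proj₁ x ≡ l} (λ {x} → missing-closed l∈L {x}) r refl
      cover : ∀ x → ∃[ t ] t ∈ map (λ l → pos l) L ++ ts × Reach f t x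
      cover x with covers x
      ... | inj₁ x∈w with t , t∈ts , r ← deduplicate-cover R? sound x∈w = t , Mem.∈-++⁺ʳ (map (λ l → pos l) L) t∈ts , r
      cover (l , Sign.+) | inj₂ l∈L = pos l , Mem.∈-++⁺ˡ (Mem.∈-map⁺ _ l∈L) , reach-refl
      cover (l , Sign.-) | inj₂ l∈L = pos l , Mem.∈-++⁺ˡ (Mem.∈-map⁺ _ l∈L) , reach-step (on-missing l∈L)
      separate : AllPairs (λ s t → ¬ Reach f s t) ts
      separate = weaken (All.tabulate ts⊆w) (deduplicate-indep R? w)
        where
        -- `vertices` follows an orbit for `length w` iterates only, which is enough as the map
        -- permutes `w`.
        weaken : ∀ {us} → All (_∈ w) us → AllPairs (λ s t → ¬ InOrbit _≟ˢ_ (λ x → next w (inverse x)) w s t) us →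
            AllPairs (λ s t → ¬ Reach f s t) us
        weaken []          []         = []
        weaken (u∈w ∷ us∈w) (¬u ∷ ¬us) = All.map (λ ¬r r → ¬r
            (reach⇒inOrbit injective′ closed′ u∈w (reach-cong (sym ∘ corners) r))) ¬u ∷ weaken us∈w ¬us
          where
          injective′ : Injective _≡_ _≡_ (λ x → next w (inverse x))
          injective′ eq = injective (trans (sym (corners _)) (trans eq (corners _)))
          closed′ : ∀ {x} → x ∈ w → next w (inverse x) ∈ w
          closed′ x∈w = subst (_∈ w) (sym (corners _)) (closed x∈w)
      indep : AllPairs (λ s t → ¬ Reach f s t) (map (λ l → pos l) L ++ ts)
      indep = AllPairsₚ.++⁺
        (AllPairsₚ.map⁺ (letters L id missing))
        separate
        (Allₚ.map⁺ (All.tabulate λ l∈L → All.tabulate λ t∈ts r → fresh (ts⊆w t∈ts)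
            (subst (_∈ L) (sym (same-letter l∈L r)) l∈L)))
        where
        letters : ∀ M → (∀ {l} → l ∈ M → l ∈ L) → Unique M → AllPairs (λ l l′ → ¬ Reach f (pos l) (pos l′)) M
        letters []      _   []         = []
        letters (l ∷ M) M⊆L (l∉ ∷ uniq) = All.map (λ l≢l′ r → l≢l′ (sym (same-letter (M⊆L (here refl)) r))) l∉ ∷
            letters M (M⊆L ∘ there) uniq

    Genus : ℕ → Set
    Genus g = count f + 2 * g ≡ length L + (⌊ length w /2⌋ + 1)

    genus⇒word : ∀ {g} → Genus g → WordHasGenus g w
    genus⇒word {g} eq = ℕ.+-cancelˡ-≡ (length L) _ _
        (trans (sym (ℕ.+-assoc (length L) (vertices w) (2 * g))) (trans (cong (_+ 2 * g) (sym count-vertices)) eq))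

    word⇒genus : ∀ {g} → WordHasGenus g w → Genus g
    word⇒genus {g} eq = trans (cong (_+ 2 * g) count-vertices)
        (trans (ℕ.+-assoc (length L) (vertices w) (2 * g)) (cong (length L +_) eq))

  open WordState

  insert-side : ∀ {l L w w₁ w₂ f h₁ h₂} (y : Side N) → proj₁ y ≡ l → WordState (l ∷ L) w f →
    Inserted h₁ y w w₁ → Inserted h₂ (inverse y) w₁ w₂ → WordState L w₂ (λ x → swap h₂ (inverse y) (swap h₁ y (f x)))
  insert-side {l} {L} {w} {w₁} {w₂} {f} {h₁} {h₂} y refl s ins₁ ins₂ = record
    { corners   = λ x → trans (next-inserted ins₂ ȳ∉w₁ unique₁ (inverse x))
                    (cong (swap h₂ (inverse y)) (trans (next-inserted ins₁ y∉w (unique s) (inverse x))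
                        (cong (swap h₁ y) (corners s x))))
    ; injective = injective s ∘ swap-injective h₁ y ∘ swap-injective h₂ (inverse y)
    ; unique    = inserted-unique ins₂ ȳ∉w₁ unique₁
    ; missing   = AllPairs.tail (missing s)
    ; fresh     = λ x∈w₂ → fresh′ (split x∈w₂)
    ; covers    = covers′
    }
    where
    y∉w : y ∉ w
    y∉w m = fresh s m (here refl)
    unique₁ : Unique w₁
    unique₁ = inserted-unique ins₁ y∉w (unique s)
    ȳ∉w₁ : inverse y ∉ w₁
    ȳ∉w₁ m with Perm.∈-resp-↭ (inserted-↭ ins₁) m
    ... | here eq  = inverse-≢ y (sym eq)
    ... | there m′ = fresh s m′ (here refl)
    w₂↭ : w₂ ↭ inverse y ∷ y ∷ w
    w₂↭ = ↭-trans (inserted-↭ ins₂) (prep (inverse y) (inserted-↭ ins₁))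
    split : ∀ {x} → x ∈ w₂ → proj₁ x ≡ l ⊎ x ∈ w
    split m with Perm.∈-resp-↭ w₂↭ m
    ... | here refl         = inj₁ refl
    ... | there (here refl) = inj₁ refl
    ... | there (there m′)  = inj₂ m′
    l∉L : l ∉ L
    l∉L m = All.lookup (AllPairs.head (missing s)) m refl
    fresh′ : ∀ {x} → proj₁ x ≡ l ⊎ x ∈ w → proj₁ x ∉ L
    fresh′ (inj₁ refl) = l∉L
    fresh′ (inj₂ m)    = fresh s m ∘ there
    side : ∀ (y : Side N) s → (proj₁ y , s) ∈ inverse y ∷ y ∷ w
    side (l , Sign.+) Sign.+ = there (here refl)
    side (l , Sign.+) Sign.- = here refl
    side (l , Sign.-) Sign.+ = here refl
    side (l , Sign.-) Sign.- = there (here refl)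
    covers′ : ∀ x → x ∈ w₂ ⊎ proj₁ x ∈ L
    covers′ x with covers s x
    ... | inj₁ m            = inj₁ (Perm.∈-resp-↭ (↭-sym w₂↭) (there (there m)))
    ... | inj₂ (there m)    = inj₂ m
    ... | inj₂ (here refl)  = inj₁ (Perm.∈-resp-↭ (↭-sym w₂↭) (side y (proj₂ x)))

  inserted-length : ∀ {h₁ h₂ y₁ y₂} {w w₁ w₂ : Word N} → Inserted h₁ y₁ w w₁ → Inserted h₂ y₂ w₁ w₂ → length w₂ ≡ 2
      + length w
  inserted-length i j = trans (Perm.↭-length (inserted-↭ j)) (cong suc (Perm.↭-length (inserted-↭ i)))

  -- The word `neg l ∷ []` has the identity as `next`, and `pos l` is inserted into it. The result
  -- is a sphere with two vertices.
  one-letter : ∀ l {L} → Unique L → l ∉ L → (∀ l′ → l′ ≡ l ⊎ l′ ∈ L) →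
    WordState L (pos l ∷ neg l ∷ []) (λ x → swap (neg l) (pos l) (inverse x))
  one-letter l {L} uniq l∉L cov = record
    { corners   = λ x → trans (next-insert-head ([] ∷ []) (λ { (here ()) ; (there ()) }) (inverse x))
        (cong (swap (neg l) (pos l)) next-single)
    ; injective = inverse-injective ∘ swap-injective (neg l) (pos l)
    ; unique    = ((λ ()) ∷ []) ∷ [] ∷ []
    ; missing   = uniq
    ; fresh     = λ { (here refl) → l∉L ; (there (here refl)) → l∉L }
    ; covers    = covers′
    }
    where
    covers′ : ∀ x → x ∈ pos l ∷ neg l ∷ [] ⊎ proj₁ x ∈ L
    covers′ (l′ , s) with cov l′
    ... | inj₂ m = inj₂ m
    covers′ (l , Sign.+) | inj₁ refl = inj₁ (here refl)
    covers′ (l , Sign.-) | inj₁ refl = inj₁ (there (here refl))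

  module Step {l L w w₁ w₂ f h₁ h₂} (y : Side N) (y-letter : proj₁ y ≡ l) (s : WordState (l ∷ L) w f)
           (ins₁ : Inserted h₁ y w w₁) (ins₂ : Inserted h₂ (inverse y) w₁ w₂) (h₂∈w : h₂ ∈ w) where

    new : ∀ {x} → x ∈ w → ∀ {y′} → proj₁ y′ ≡ l → x ≢ y′
    new x∈w refl refl = fresh s x∈w (here refl)

    open Attach (injective s) {y} {inverse y}
      (on-missing s {y} (here y-letter)) (trans (on-missing s {inverse y} (here y-letter)) (inverse-involutive y))
          (inverse-≢ y)
      (new (corner-∈ ins₁) y-letter) (new (corner-∈ ins₁) y-letter) (new h₂∈w y-letter) (new h₂∈w y-letter) public

    state : WordState L w₂ attached
    state = insert-side y y-letter s ins₁ ins₂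

    private
      regroup : ∀ a b c g → a + 2 * g ≡ suc b + (c + 1) → a + 2 * g ≡ b + (suc c + 1)
      regroup a b c g eq = trans eq (sym (ℕ.+-suc b (c + 1)))

      lengths : length L + (⌊ 2 + length w /2⌋ + 1) ≡ length L + (⌊ length w₂ /2⌋ + 1)
      lengths = cong (λ k → length L + (⌊ k /2⌋ + 1)) (sym (inserted-length ins₁ ins₂))

    -- Attaching a letter takes one entry from `L` and adds one edge, so the right side of `Genus`
    -- does not change and the number of orbits alone decides the genus.
    genus-kept : ∀ {g} → Genus s g → count attached ≡ count f → Genus state g
    genus-kept {g} eq same = trans (cong (_+ 2 * g) same)
        (trans (regroup (count f) (length L) ⌊ length w /2⌋ g eq) lengths)

    genus-raised : ∀ {g} → Genus s g → count f ≡ 2 + count attached → Genus state (suc g)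
    genus-raised {g} eq less = trans (raise (count attached))
      (trans (regroup (2 + count attached) (length L) ⌊ length w /2⌋ g (trans (cong (_+ 2 * g) (sym less)) eq)) lengths)
      where
      open +-*-Solver
      raise : ∀ c → c + 2 * suc g ≡ 2 + c + 2 * g
      raise c = solve 2 (λ c g → c :+ con 2 :* (con 1 :+ g) := con 2 :+ c :+ con 2 :* g) refl c g

  -- The last argument is the block built so far. One subset drives both functions: a letter inside
  -- it is prepended to one block, a letter outside it is appended to the other.
  prepended appended : (Letter N → Side N) → Vec (Letter N) m → Subset m → Word N → Word N
  prepended f []ᵛ       []ᵛ            X = X
  prepended f (l ∷ᵛ ls) (inside  ∷ᵛ K) X = prepended f ls K (f l ∷ X)
  prepended f (l ∷ᵛ ls) (outside ∷ᵛ K) X = prepended f ls K X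
  appended f []ᵛ       []ᵛ            X = X
  appended f (l ∷ᵛ ls) (inside  ∷ᵛ K) X = appended f ls K X
  appended f (l ∷ᵛ ls) (outside ∷ᵛ K) X = appended f ls K (X ++ [ f l ])

  fixed⇒reach-≡ : ∀ {f : Side N → Side N} {x y} → f x ≡ x → Reach f x y → y ≡ x
  fixed⇒reach-≡ {f} {x} fx r = reach-inv {P = λ y → y ≡ x} (λ { refl → fx }) r refl

  Corners : Kind → (Side N → Side N) → Side N → Side N → Set
  Corners apart  f x y = ¬ Reach f x y
  Corners joined f x y = Reach f x y

  ++-nonempty : (xs : List A) (y : A) (zs : List A) → ∃[ h ] ∃[ t ] xs ++ y ∷ zs ≡ h ∷ t
  ++-nonempty []       y zs = y , zs , refl
  ++-nonempty (x ∷ xs) y zs = x , xs ++ y ∷ zs , refl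

  -- The word is a R₁ R₄ a⁻ R₂ R₃.  With q = a⁻, the corners at which the next
  -- letter may be attached are f q (the start of R₁), q (the end of R₄) and r
  -- (between R₂ and R₃); the first two always belong to the same vertex.
  module SurfaceSix where

    a q : Side N
    a = pos nothing
    q = neg nothing

    word : (A E B C : Word N) → Word N
    word A E B C = a ∷ A ++ E ++ q ∷ B ++ C

    slide : ∀ A E B C y → word A E (B ++ [ y ]) C ≡ word A E B (y ∷ C)
    slide A E B C y = cong (λ X → a ∷ A ++ E ++ q ∷ X) (List.++-assoc B [ y ] C)

    at-start : ∀ A E B C {p t} y → A ++ E ++ q ∷ B ++ C ≡ p ∷ t → Inserted p y (word A E B C) (word (y ∷ A) E B C)
    at-start A E B C y eq = inserted [ a ] (A ++ E ++ q ∷ B ++ C) refl refl (cong (_++ [ a ]) eq)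

    at-middle : ∀ A E B C y → Inserted q y (word A E B C) (word A (E ++ [ y ]) B C)
    at-middle A E B C y = inserted (a ∷ A ++ E) (q ∷ B ++ C)
      (cong (a ∷_) (sym (List.++-assoc A E _)))
      (cong (a ∷_) (trans (cong (A ++_) (List.++-assoc E [ y ] _)) (sym (List.++-assoc A E _))))
      refl

    at-end : ∀ A E B C {r t} y → C ++ [ a ] ≡ r ∷ t → Inserted r y (word A E B C) (word A E B (y ∷ C))
    at-end A E B C y eq = inserted (a ∷ A ++ E ++ q ∷ B) C (assoc C) (assoc (y ∷ C))
      (trans (sym (List.++-assoc C [ a ] _)) (cong (_++ (A ++ E ++ q ∷ B)) eq))
      where
      assoc : ∀ C → word A E B C ≡ (a ∷ A ++ E ++ q ∷ B) ++ C
      assoc C = cong (a ∷_) (sym (trans (List.++-assoc A (E ++ q ∷ B) C) (cong (A ++_) (List.++-assoc E (q ∷ B) C))))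

    -- The corner `r` starts with the head of R₃, or with `a` in the cyclic word if R₃ is empty;
    -- hence `C ++ [ a ]`. The inequalities ensure that an insertion at `r` leaves the other two
    -- corners in place.
    record State (L : List (Letter N)) (A E B C : Word N) (f : Side N → Side N) (r : Side N) : Set where
      constructor mk
      field
        state   : WordState L (word A E B C) f
        {rest}  : Word N
        end     : C ++ [ a ] ≡ r ∷ rest
        q≢r     : q ≢ r
        fq≢r    : f q ≢ r

      r∈w : r ∈ word A E B C
      r∈w = corner-∈ (at-end A E B C q end)

      q∈w : q ∈ word A E B C
      q∈w = there (Mem.∈-++⁺ʳ A (Mem.∈-++⁺ʳ E (here refl)))

      fq∈w : f q ∈ word A E B C
      fq∈w = closed state q∈w

      -- The corner map sends `q` to the side after its inverse `a`, which is where R₁ starts.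
      start : ∃[ t ] A ++ E ++ q ∷ B ++ C ≡ f q ∷ t
      start with p , t , eq ← ++-nonempty (A ++ E) q (B ++ C) = t , trans eq′
          (cong (_∷ t) (trans (sym (trans (cong (λ w → next (a ∷ w) a) eq′) (next-head a p t))) (corners state q)))
        where
        eq′ : A ++ E ++ q ∷ B ++ C ≡ p ∷ t
        eq′ = trans (sym (List.++-assoc A E _)) eq

    module _ {l L A E B C f r} (st : State (l ∷ L) A E B C f r) where
      open State st

      private
        l⁺ = pos l
        l⁻ = neg l

      module InIn = Step l⁺ refl state (at-start A E B C l⁺ (proj₂ start)) (at-end (l⁺ ∷ A) E B C l⁻ end) r∈w

      in-in-q : InIn.attached q ≡ l⁺
      in-in-q = trans (cong (swap r l⁻) (swap-left (f q) l⁺)) (swap-other (InIn.new r∈w refl ∘ sym) (inverse-≢ l⁺))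

      in-in : State L (l⁺ ∷ A) E B (l⁻ ∷ C) InIn.attached l⁻
      in-in = mk InIn.state refl (InIn.new q∈w refl) (λ eq → inverse-≢ l⁺ (trans (sym in-in-q) eq))

      in-in-q~r : Reach InIn.attached q r
      in-in-q~r = reach-trans (reach-step in-in-q) (reach-step InIn.attached-n)

      module InOut = Step l⁺ refl state (at-start A E B C l⁺ (proj₂ start)) (at-middle (l⁺ ∷ A) E B C l⁻) q∈w

      in-out-q : InOut.attached q ≡ l⁺
      in-out-q = trans (cong (swap q l⁻) (swap-left (f q) l⁺)) (swap-other (InOut.new q∈w refl ∘ sym) (inverse-≢ l⁺))

      in-out : State L (l⁺ ∷ A) (E ++ [ l⁻ ]) B C InOut.attached r
      in-out = mk InOut.state end q≢r (λ eq → InOut.new r∈w {l⁺} refl (trans (sym eq) in-out-q))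

      -- `q` and `l⁺` have become an orbit of their own.
      in-out-apart : ¬ Reach InOut.attached q r
      in-out-apart q~r = excluded (reach-inv {P = λ x → x ≡ q ⊎ x ≡ l⁺}
          (λ { (inj₁ refl) → inj₂ in-out-q ; (inj₂ refl) → inj₁ InOut.attached-n }) q~r (inj₁ refl))
        where
        excluded : ¬ (r ≡ q ⊎ r ≡ l⁺)
        excluded (inj₁ r≡q) = q≢r (sym r≡q)
        excluded (inj₂ r≡l⁺) = InOut.new r∈w refl r≡l⁺

      module OutIn = Step l⁺ refl state (subst (Inserted r l⁺ (word A E B C)) (sym (slide A E B C l⁺))
          (at-end A E B C l⁺ end)) (at-end A E (B ++ [ l⁺ ]) C l⁻ end) r∈w

      out-in : State L A E (B ++ [ l⁺ ]) (l⁻ ∷ C) OutIn.attached l⁻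
      out-in = mk OutIn.state refl (OutIn.new q∈w refl) (λ eq → OutIn.new fq∈w {l⁻} refl (trans (sym fixed) eq))
        where
        fixed : OutIn.attached q ≡ f q
        fixed = trans (cong (swap r l⁻) (swap-other fq≢r (OutIn.new fq∈w refl))) (swap-other fq≢r (OutIn.new fq∈w refl))

      -- Both ends sit at the same corner, so the word contains `l⁺` followed by `l⁻`, and the
      -- vertex between them consists of `l⁻` alone.
      out-in-apart : ¬ Reach OutIn.attached q l⁻
      out-in-apart q~m = OutIn.new q∈w refl (fixed⇒reach-≡ (OutIn.attached-fixes-m refl)
          (reach-sym OutIn.attached-injective q~m))

      module OutOut = Step l⁺ refl state (subst (Inserted r l⁺ (word A E B C)) (sym (slide A E B C l⁺))
          (at-end A E B C l⁺ end)) (at-middle A E (B ++ [ l⁺ ]) C l⁻) q∈w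

      out-out : State L A (E ++ [ l⁻ ]) (B ++ [ l⁺ ]) C OutOut.attached r
      out-out = mk OutOut.state end q≢r moved
        where
        half-q : swap r l⁺ (f q) ≡ f q
        half-q = swap-other fq≢r (OutOut.new fq∈w refl)
        moved : OutOut.attached q ≢ r
        moved eq with swapCase q l⁻ (f q)
        ... | left  _ eq′   = OutOut.new r∈w {l⁻} refl (trans (sym eq) (trans (cong (swap q l⁻) half-q) eq′))
        ... | right _ eq′   = q≢r (trans (sym eq′) (trans (sym (cong (swap q l⁻) half-q)) eq))
        ... | other _ _ eq′ = fq≢r (trans (sym eq′) (trans (sym (cong (swap q l⁻) half-q)) eq))

    -- `in-out` attaches at `f q` and `q`, `out-in` twice at `r`: always a single vertex. `in-in`
    -- and `out-out` attach at `r` and at one of `f q` and `q`, so for them the kind decides.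
    behaves : ∀ κ {m} (ls : Vec (Letter N) m) A E B C {f r g} (st : State (Vec.toList ls) A E B C f r) →
      Genus (State.state st) g → Corners κ f q r →
      Behaves κ m g (λ K T → word (prepended (λ l → pos l) ls K A) (appended (λ l → neg l) ls T E)
          (appended (λ l → pos l) ls K B) (prepended (λ l → neg l) ls T C))
    behaves κ []ᵛ A E B C {g = g} st genus _ = done (genus⇒word (State.state st) {g} genus)
    behaves apart (l ∷ᵛ ls) A E B C {f} {r} {g} st genus ¬q~r = apart
      (λ { true  → behaves apart ls _ _ _ _ (in-out st)
          (InOut.genus-kept st {g} genus (proj₁ (InOut.attach-split st (reach-step refl)))) (in-out-apart st)
         ; false → behaves apart ls _ _ _ _ (out-in st)
             (OutIn.genus-kept st {g} genus (proj₁ (OutIn.attach-split st reach-refl))) (out-in-apart st) })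
      (λ { true  → behaves joined ls _ _ _ _ (in-in st)
          (InIn.genus-raised st {g} genus (InIn.attach-count st ¬r~fq))
          (reach-trans (in-in-q~r st) (InIn.attach-joins st ¬r~fq))
         ; false → behaves joined ls _ _ _ _ (out-out st)
             (OutOut.genus-raised st {g} genus (OutOut.attach-count st ¬q~r)) (OutOut.attach-joins-h st ¬q~r) })
      where
      ¬r~fq : ¬ Reach f r (f q)
      ¬r~fq r~fq = ¬q~r (reach-trans (reach-step refl) (reach-sym (injective (State.state st)) r~fq))
    behaves joined (l ∷ᵛ ls) A E B C {f} {r} {g} st genus q~r = joined
      λ { true  true  → behaves apart ls _ _ _ _ (in-in st)
          (InIn.genus-kept st {g} genus (proj₁ (InIn.attach-split st r~fq)))
                          (λ q~m → proj₂ (InIn.attach-split st r~fq) (reach-trans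
                              (reach-sym (InIn.attached-injective st) (in-in-q~r st)) q~m))
        ; true  false → behaves apart ls _ _ _ _ (in-out st)
            (InOut.genus-kept st {g} genus (proj₁ (InOut.attach-split st (reach-step refl)))) (in-out-apart st)
        ; false true  → behaves apart ls _ _ _ _ (out-in st)
            (OutIn.genus-kept st {g} genus (proj₁ (OutIn.attach-split st reach-refl))) (out-in-apart st)
        ; false false → behaves apart ls _ _ _ _ (out-out st)
            (OutOut.genus-kept st {g} genus (proj₁ (OutOut.attach-split st q~r)))
                          -- The split separates `q` from `l⁻`, and `l⁻` leads to `r`.
                          (λ q~′r → proj₂ (OutOut.attach-split st q~r) (reach-trans q~′r
                              (reach-sym (OutOut.attached-injective st) (reach-step
                              (OutOut.attached-m st (State.q≢r st ∘ sym)))))) }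
      where
      r~fq : Reach f r (f q)
      r~fq = reach-trans (reach-sym (injective (State.state st)) q~r) (reach-step refl)

  -- The word is R₁ R₂ R₃ R₄; p is the corner between R₄ and R₁, and r the one
  -- between R₂ and R₃.
  module SurfaceOne where

    word : (A B C E : Word N) → Word N
    word A B C E = A ++ B ++ C ++ E

    slide : ∀ A B C E y → word A (B ++ [ y ]) C E ≡ word A B (y ∷ C) E
    slide A B C E y = cong (A ++_) (List.++-assoc B [ y ] _)

    module _ (A B C E : Word N) where

      halves : word A B C E ≡ (A ++ B) ++ C ++ E
      halves = sym (List.++-assoc A B _)

      at-front : ∀ {p t} y → A ++ B ≡ p ∷ t → Inserted p y (word A B C E) (word (y ∷ A) B C E)
      at-front y eq = inserted [] (word A B C E) refl refl
          (trans (List.++-identityʳ _) (trans halves (cong (_++ C ++ E) eq)))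

      at-back : ∀ {p t} y → A ++ B ≡ p ∷ t → Inserted p y (word A B C E) (word A B C (E ++ [ y ]))
      at-back y eq = inserted (word A B C E) [] (sym (List.++-identityʳ _))
        (sym (trans (List.++-assoc A _ [ y ]) (cong (A ++_)
            (trans (List.++-assoc B _ [ y ]) (cong (B ++_) (List.++-assoc C E [ y ]))))))
        (trans halves (cong (_++ C ++ E) eq))

      at-middle : ∀ {r t} y → C ++ E ≡ r ∷ t → Inserted r y (word A B C E) (word A B (y ∷ C) E)
      at-middle y eq = inserted (A ++ B) (C ++ E) halves (sym (List.++-assoc A B _)) (cong (_++ A ++ B) eq)

      at-middle′ : ∀ {r t} y → C ++ E ≡ r ∷ t → Inserted r y (word A B C E) (word A (B ++ [ y ]) C E)
      at-middle′ y eq = subst (Inserted _ y (word A B C E)) (sym (slide A B C E y)) (at-middle y eq)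

    record State (L : List (Letter N)) (A B C E : Word N) (f : Side N → Side N) (p r : Side N) : Set where
      constructor mk
      field
        state          : WordState L (word A B C E) f
        {restₚ restᵣ}  : Word N
        front          : A ++ B ≡ p ∷ restₚ
        middle         : C ++ E ≡ r ∷ restᵣ
        p≢r            : p ≢ r

      p∈w : p ∈ word A B C E
      p∈w = corner-∈ (at-front A B C E p front)

      r∈w : r ∈ word A B C E
      r∈w = corner-∈ (at-middle A B C E r middle)

    module _ {l L A B C E f p r} (st : State (l ∷ L) A B C E f p r) where
      open State st

      private
        l⁺ = pos l
        l⁻ = neg l

        snoc : ∀ {xs ys : Word N} {h t} y → xs ++ ys ≡ h ∷ t → xs ++ ys ++ [ y ] ≡ h ∷ t ++ [ y ]
        snoc {xs} {ys} y eq = trans (sym (List.++-assoc xs ys [ y ])) (cong (_++ [ y ]) eq)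

      module InIn = Step l⁺ refl state (at-front A B C E l⁺ front) (at-middle (l⁺ ∷ A) B C E l⁻ middle) r∈w

      in-in : State L (l⁺ ∷ A) B (l⁻ ∷ C) E InIn.attached l⁺ l⁻
      in-in = mk InIn.state refl refl (inverse-≢ l⁺)

      -- The word reads … l⁻ l⁺ … at p, so that l⁻ has to be inserted first.
      module InOut = Step l⁻ refl state (at-back A B C E l⁻ front) (at-front A B C (E ++ [ l⁻ ]) l⁺ front) p∈w

      in-out : State L (l⁺ ∷ A) B C (E ++ [ l⁻ ]) InOut.attached l⁺ r
      in-out = mk InOut.state refl (snoc {C} l⁻ middle) (InOut.new r∈w refl ∘ sym)

      in-out-apart : ¬ Reach InOut.attached l⁺ r
      in-out-apart l⁺~r = InOut.new r∈w refl (fixed⇒reach-≡ (InOut.attached-fixes-m refl) l⁺~r)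

      module OutIn = Step l⁺ refl state (at-middle′ A B C E l⁺ middle) (at-middle A (B ++ [ l⁺ ]) C E l⁻ middle) r∈w

      out-in : State L A (B ++ [ l⁺ ]) (l⁻ ∷ C) E OutIn.attached p l⁻
      out-in = mk OutIn.state (snoc {A} l⁺ front) refl (OutIn.new p∈w refl)

      out-in-apart : ¬ Reach OutIn.attached p l⁻
      out-in-apart p~l⁻ = OutIn.new p∈w refl (fixed⇒reach-≡ (OutIn.attached-fixes-m refl)
          (reach-sym OutIn.attached-injective p~l⁻))

      module OutOut = Step l⁺ refl state (at-middle′ A B C E l⁺ middle)
          (at-back A (B ++ [ l⁺ ]) C E l⁻ (snoc {A} l⁺ front)) p∈w

      out-out : State L A (B ++ [ l⁺ ]) C (E ++ [ l⁻ ]) OutOut.attached p r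
      out-out = mk OutOut.state (snoc {A} l⁺ front) (snoc {C} l⁻ middle) p≢r

    -- `L` holds the letters that stay missing to the end; in this family that is `a`.
    behaves : ∀ κ {m} (ls : Vec (Letter N) m) {L} A B C E {f p r g} (st : State (Vec.toList ls ++ L) A B C E f p r) →
      Genus (State.state st) g → Corners κ f p r →
      Behaves κ m g (λ K T → word (prepended (λ l → pos l) ls K A) (appended (λ l → pos l) ls K B)
          (prepended (λ l → neg l) ls T C) (appended (λ l → neg l) ls T E))
    behaves κ []ᵛ A B C E {g = g} st genus _ = done (genus⇒word (State.state st) {g} genus)
    behaves apart (l ∷ᵛ ls) A B C E {f} {p} {r} {g} st genus ¬p~r = apart
      (λ { true  → behaves apart ls _ _ _ _ (in-out st)
          (InOut.genus-kept st {g} genus (proj₁ (InOut.attach-split st reach-refl))) (in-out-apart st)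
         ; false → behaves apart ls _ _ _ _ (out-in st)
             (OutIn.genus-kept st {g} genus (proj₁ (OutIn.attach-split st reach-refl))) (out-in-apart st) })
      (λ { true  → behaves joined ls _ _ _ _ (in-in st) (InIn.genus-raised st {g} genus (InIn.attach-count st ¬r~p))
          (reach-trans (reach-step (InIn.attached-n st)) (InIn.attach-joins st ¬r~p))
         ; false → behaves joined ls _ _ _ _ (out-out st)
             (OutOut.genus-raised st {g} genus (OutOut.attach-count st ¬p~r)) (OutOut.attach-joins-h st ¬p~r) })
      where
      ¬r~p : ¬ Reach f r p
      ¬r~p r~p = ¬p~r (reach-sym (injective (State.state st)) r~p)
    behaves joined (l ∷ᵛ ls) A B C E {f} {p} {r} {g} st genus p~r = joined
      λ { true  true  → behaves apart ls _ _ _ _ (in-in st)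
          (InIn.genus-kept st {g} genus (proj₁ (InIn.attach-split st r~p)))
                          (λ l⁺~l⁻ → proj₂ (InIn.attach-split st r~p) (reach-trans
                              (reach-sym (InIn.attached-injective st) (reach-step (InIn.attached-n st))) l⁺~l⁻))
        ; true  false → behaves apart ls _ _ _ _ (in-out st)
            (InOut.genus-kept st {g} genus (proj₁ (InOut.attach-split st reach-refl))) (in-out-apart st)
        ; false true  → behaves apart ls _ _ _ _ (out-in st)
            (OutIn.genus-kept st {g} genus (proj₁ (OutIn.attach-split st reach-refl))) (out-in-apart st)
        ; false false → behaves apart ls _ _ _ _ (out-out st)
            (OutOut.genus-kept st {g} genus (proj₁ (OutOut.attach-split st p~r)))
                          (λ p~′r → proj₂ (OutOut.attach-split st p~r) (reach-trans p~′r
                              (reach-sym (OutOut.attached-injective st) (reach-step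
                              (OutOut.attached-m st (State.p≢r st ∘ sym)))))) }
      where
      r~p : Reach f r p
      r~p = reach-sym (injective (State.state st)) p~r

-- The words built letter by letter are those of the two families

module _ {N : ℕ} where

  private
    chosen : Subset m → List (Fin m)
    chosen K = filter (_∈? K) (allFin _)

    chosen-suc : ∀ k (K : Subset m) → filter (_∈? (k ∷ᵛ K)) (tabulate suc) ≡ map suc (chosen K)
    chosen-suc {m} k K = trans (cong (filter (_∈? (k ∷ᵛ K))) (sym (List.map-tabulate id suc))) (filter-suc (allFin m))
      where
      filter-suc : ∀ is → filter (_∈? (k ∷ᵛ K)) (map suc is) ≡ map suc (filter (_∈? K) is)
      filter-suc []       = refl
      filter-suc (i ∷ is) with i ∈? K
      ... | yes _ = cong (suc i ∷_) (filter-suc is)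
      ... | no  _ = filter-suc is

    reindex : ∀ (h : Fin (suc m) → Letter N) k (K : Subset m) → map h (filter (_∈? (k ∷ᵛ K)) (tabulate suc)) ≡ map
        (h ∘ suc) (chosen K)
    reindex h k K = trans (cong (map h) (chosen-suc k K)) (sym (List.map-∘ (chosen K)))

  -- The naming `h` of the letters is arbitrary so that the induction can pass to `h ∘ suc`.
  prepended-chosen : ∀ f (h : Fin m → Letter N) K X → prepended f (Vec.tabulate h) K X ≡ map f
      (reverse (map h (chosen K))) ++ X
  prepended-chosen f h []ᵛ            X = refl
  prepended-chosen f h (inside  ∷ᵛ K) X = begin
    prepended f (Vec.tabulate (h ∘ suc)) K (f (h zero) ∷ X)              ≡⟨ prepended-chosen f (h ∘ suc) K _ ⟩
    map f (reverse (map (h ∘ suc) (chosen K))) ++ f (h zero) ∷ X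
        ≡⟨ List.++-assoc (map f (reverse (map (h ∘ suc) (chosen K)))) [ f (h zero) ] X ⟨
    (map f (reverse (map (h ∘ suc) (chosen K))) ++ [ f (h zero) ]) ++ X
        ≡⟨ cong (_++ X) (List.map-++ f (reverse (map (h ∘ suc) (chosen K))) [ h zero ]) ⟨
    map f (reverse (map (h ∘ suc) (chosen K)) ++ [ h zero ]) ++ X
        ≡⟨ cong (λ ls → map f ls ++ X) (List.unfold-reverse (h zero) (map (h ∘ suc) (chosen K))) ⟨
    map f (reverse (h zero ∷ map (h ∘ suc) (chosen K))) ++ X
        ≡⟨ cong (λ ls → map f (reverse (h zero ∷ ls)) ++ X) (reindex h inside K) ⟨
    map f (reverse (map h (chosen (inside ∷ᵛ K)))) ++ X                  ∎
    where open ≡-Reasoning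
  prepended-chosen f h (outside ∷ᵛ K) X = trans (prepended-chosen f (h ∘ suc) K X)
      (cong (λ ls → map f (reverse ls) ++ X) (sym (reindex h outside K)))

  appended-chosen : ∀ f (h : Fin m → Letter N) K X → appended f (Vec.tabulate h) K X ≡ X ++ map f (map h (chosen (∁ K)))
  appended-chosen f h []ᵛ            X = sym (List.++-identityʳ X)
  appended-chosen f h (inside  ∷ᵛ K) X = trans (appended-chosen f (h ∘ suc) K X)
      (cong (λ ls → X ++ map f ls) (sym (reindex h outside (∁ K))))
  appended-chosen f h (outside ∷ᵛ K) X = begin
    appended f (Vec.tabulate (h ∘ suc)) K (X ++ [ f (h zero) ])          ≡⟨ appended-chosen f (h ∘ suc) K _ ⟩
    (X ++ [ f (h zero) ]) ++ map f (map (h ∘ suc) (chosen (∁ K)))        ≡⟨ List.++-assoc X _ _ ⟩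
    X ++ f (h zero) ∷ map f (map (h ∘ suc) (chosen (∁ K)))
        ≡⟨ cong (λ ls → X ++ f (h zero) ∷ map f ls) (reindex h inside (∁ K)) ⟨
    X ++ map f (map h (chosen (∁ (outside ∷ᵛ K))))                       ∎
    where open ≡-Reasoning

toList-tabulate : (h : Fin m → A) → Vec.toList (Vec.tabulate h) ≡ tabulate h
toList-tabulate {zero}  h = refl
toList-tabulate {suc m} h = cong (h zero ∷_) (toList-tabulate (h ∘ suc))

prepended-decreasing : ∀ f (K : Subset N) → prepended f (Vec.tabulate just) K [] ≡ map f (decreasing K)
prepended-decreasing f K = trans (prepended-chosen f just K []) (List.++-identityʳ _)

appended-increasing : ∀ f (K : Subset N) → appended f (Vec.tabulate just) K [] ≡ map f (increasing (∁ K))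
appended-increasing f K = appended-chosen f just K []

-- Before any indexed letter is attached the word is `a` followed by its inverse: a sphere on which
-- `q` and `r` are different vertices.
surfacePoly-S₆ : ∀ n → surfacePoly n S₆ ≗ pieces apart n
surfacePoly-S₆ n g = begin
  surfacePoly n S₆ g ≡⟨ surfacePoly-total n S₆ g ⟩
  total n S₆ g       ≡⟨ total-cong same g ⟩
  total n (λ K T → SurfaceSix.word (prepended (λ l → pos l) ls K []) (appended (λ l → neg l) ls T [])
      (appended (λ l → pos l) ls K []) (prepended (λ l → neg l) ls T [])) g
    ≡⟨ behaves-total {d = 0} (SurfaceSix.behaves apart ls [] [] [] [] start genus separate) g ⟩
  pieces apart n g   ∎
  where
  open ≡-Reasoning
  open Orbits (_≟ˢ_ {n})
  ls : Vec (Letter n) n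
  ls = Vec.tabulate just
  same : ∀ K T → S₆ K T ≡ SurfaceSix.word (prepended (λ l → pos l) ls K []) (appended (λ l → neg l) ls T [])
      (appended (λ l → pos l) ls K []) (prepended (λ l → neg l) ls T [])
  same K T rewrite prepended-decreasing (λ l → pos l) K | appended-increasing (λ l → neg l) T | appended-increasing
      (λ l → pos l) K | prepended-decreasing (λ l → neg l) T = refl
  letters : Unique (tabulate {A = Letter n} just) × nothing ∉ tabulate {A = Letter n} just ×
      (∀ l → l ≡ nothing ⊎ l ∈ tabulate {A = Letter n} just)
  letters = Uniqueₚ.tabulate⁺ Maybe.just-injective
          , (λ m → case-nothing (Mem.∈-tabulate⁻ m))
          , λ { nothing → inj₁ refl ; (just i) → inj₂ (Mem.∈-tabulate⁺ i) }
    where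
    case-nothing : ¬ (∃[ i ] nothing ≡ just i)
    case-nothing (_ , ())
  letters′ : Unique (Vec.toList ls) × nothing ∉ Vec.toList ls × (∀ l → l ≡ nothing ⊎ l ∈ Vec.toList ls)
  letters′ = subst (λ L → Unique L × nothing ∉ L × (∀ l → l ≡ nothing ⊎ l ∈ L)) (sym (toList-tabulate just)) letters
  start = SurfaceSix.mk (one-letter nothing (proj₁ letters′) (proj₁ (proj₂ letters′)) (proj₂ (proj₂ letters′))) refl
      (λ ()) (λ ())
  genus = WordState.word⇒genus (SurfaceSix.State.state start) {0} refl
  separate : ¬ Reach _ (neg nothing) (pos nothing)
  separate r with () ← fixed⇒reach-≡ refl r

-- The empty polygon has no corner to start from, so the first letter is placed by hand. All four
-- choices give the same two-sided word, a sphere with the two corners apart, exactly as in a step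
-- from `joined`.
surfacePoly-S₁ : ∀ n → surfacePoly (suc n) S₁ ≗ pieces joined (suc n)
surfacePoly-S₁ n g = begin
  surfacePoly (suc n) S₁ g ≡⟨ surfacePoly-total (suc n) S₁ g ⟩
  total (suc n) S₁ g       ≡⟨ total-cong same g ⟩
  total (suc n) W g        ≡⟨ behaves-total {d = 0} W-behaves g ⟩
  pieces joined (suc n) g  ∎
  where
  open ≡-Reasoning
  open Orbits (_≟ˢ_ {suc n})
  ls : Vec (Letter (suc n)) (suc n)
  ls = Vec.tabulate just
  ls′ : Vec (Letter (suc n)) n
  ls′ = Vec.tabulate (just ∘ suc)
  W : Subset (suc n) → Subset (suc n) → Word (suc n)
  W K T = SurfaceOne.word (prepended (λ l → pos l) ls K []) (appended (λ l → pos l) ls K [])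
      (prepended (λ l → neg l) ls T []) (appended (λ l → neg l) ls T [])
  same : ∀ K T → S₁ K T ≡ W K T
  same K T rewrite prepended-decreasing (λ l → pos l) K | appended-increasing (λ l → pos l) K | prepended-decreasing
      (λ l → neg l) T | appended-increasing (λ l → neg l) T = refl
  L = tabulate {A = Letter (suc n)} (just ∘ suc) ++ [ nothing ]
  toList-ls′ : Vec.toList ls′ ++ [ nothing ] ≡ L
  toList-ls′ = cong (_++ [ nothing ]) (toList-tabulate (just ∘ suc))
  f : Side (suc n) → Side (suc n)
  f x = swap (neg (just zero)) (pos (just zero)) (inverse x)
  first : WordState (Vec.toList ls′ ++ [ nothing ]) (pos (just zero) ∷ neg (just zero) ∷ []) f
  first = subst (λ L → WordState L (pos (just zero) ∷ neg (just zero) ∷ []) f) (sym toList-ls′)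
      (one-letter (just zero) unique-L zero∉L covers-L)
    where
    unique-L : Unique L
    unique-L = AllPairsₚ.++⁺ (Uniqueₚ.tabulate⁺ (Fin.suc-injective ∘ Maybe.just-injective)) ([] ∷ [])
      (Allₚ.tabulate⁺ λ i → (λ ()) ∷ [])
    zero∉L : just zero ∉ L
    zero∉L m with Mem.∈-++⁻ (tabulate (just ∘ suc)) m
    ... | inj₁ m′ with _ , () ← Mem.∈-tabulate⁻ m′
    ... | inj₂ (here ())
    covers-L : ∀ l → l ≡ just zero ⊎ l ∈ L
    covers-L nothing        = inj₂ (Mem.∈-++⁺ʳ (tabulate (just ∘ suc)) (here refl))
    covers-L (just zero)    = inj₁ refl
    covers-L (just (suc i)) = inj₂ (Mem.∈-++⁺ˡ (Mem.∈-tabulate⁺ i))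
  genus = WordState.word⇒genus first {0} refl
  separate : ¬ Reach f (pos (just zero)) (neg (just zero))
  separate r with () ← fixed⇒reach-≡ refl r
  W-behaves : Behaves joined (suc n) 0 W
  W-behaves = joined
    λ { true  true  → SurfaceOne.behaves apart ls′ _ _ _ _ (SurfaceOne.mk first refl refl (λ ())) genus separate
      ; true  false → SurfaceOne.behaves apart ls′ _ _ _ _ (SurfaceOne.mk first refl refl (λ ())) genus separate
      ; false true  → SurfaceOne.behaves apart ls′ _ _ _ _ (SurfaceOne.mk first refl refl (λ ())) genus separate
      ; false false → SurfaceOne.behaves apart ls′ _ _ _ _ (SurfaceOne.mk first refl refl (λ ())) genus separate }

-- Genera of the embeddings of a graph

module _ (G : Graph) where

  open Graph G using (order; size; base; flip; darts; Dart; _≟ᵈ_; Table; tables; apply; IsRotation; isRotation?;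
      faces; HasGenus; hasGenus?; embeddings; genusPoly)

  ∈-darts : ∀ d → d ∈ darts
  ∈-darts (e , s) = Mem.∈-cartesianProduct⁺ (Mem.∈-allFin e) (Mem.∈-allFin s)

  open Orbits _≟ᵈ_
  open Finite darts ∈-darts

  -- Functions instead of tables, so that transpositions can be composed with them; `table` leads
  -- back.
  record Rotation (ρ : Dart → Dart) : Set where
    field
      injective  : Injective _≡_ _≡_ ρ
      at-vertex  : ∀ d → base (ρ d) ≡ base d
      transitive : ∀ d d′ → base d ≡ base d′ → Reach ρ d d′

  open Rotation

  iter-period : ∀ (f : Dart → Dart) k {z} → iter f (suc k) z ≡ z → ∀ j → iter f (j * suc k + k) z ≡ iter f k z
  iter-period f k ret zero    = refl
  iter-period f k {z} ret (suc j) = trans (cong (λ i → iter f i z) (ℕ.+-assoc (suc k) (j * suc k) k))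
    (trans (iter-+ f (suc k) (j * suc k + k) z) (trans (cong (iter f (j * suc k + k)) ret) (iter-period f k ret j)))

  isRotation⇒rotation : ∀ t → IsRotation t → Rotation (apply t)
  isRotation⇒rotation t (vertex , orbits) = record { injective = inj ; at-vertex = at-v ; transitive = trans-v }
    where
    ρ = apply t
    at-v : ∀ d → base (ρ d) ≡ base d
    at-v d = All.lookup vertex (∈-darts d)
    trans-v : ∀ d d′ → base d ≡ base d′ → Reach ρ d d′
    trans-v d d′ eq = inOrbit⇒reach ρ darts (All.lookup (All.lookup orbits (∈-darts d)) (∈-darts d′) eq)
    -- The common image of `x` and `y` returns to itself after `suc k` steps, the last one from `x`,
    -- and after `suc l` steps, the last one from `y`. One step before time `suc k * suc l` the
    -- orbit is therefore both at `x` and at `y`.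
    inj : Injective _≡_ _≡_ ρ
    inj {x} {y} eq = let k , p = trans-v (ρ x) x (at-v x) ; l , q = trans-v (ρ x) y (trans (cong base eq) (at-v y)) in
      trans (sym p) (trans (sym (iter-period ρ k (trans (iter-suc ρ k (ρ x)) (cong ρ p)) l))
        (trans (cong (λ i → iter ρ i (ρ x)) (symmetric k l))
          (trans (iter-period ρ l (trans (iter-suc ρ l (ρ x)) (trans (cong ρ q) (sym eq))) k) q)))
      where
      open +-*-Solver
      symmetric : ∀ k l → l * suc k + k ≡ k * suc l + l
      symmetric = solve 2 (λ k l → l :* (con 1 :+ k) :+ k := k :* (con 1 :+ l) :+ l) refl

  rotation⇒isRotation : ∀ t → Rotation (apply t) → IsRotation t
  rotation⇒isRotation t r =
      All.tabulate (λ {d} _ → at-vertex r d)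
    , All.tabulate (λ {d} _ → All.tabulate λ {d′} _ eq → reach⇒inOrbit (injective r) (λ _ → ∈-darts _) (∈-darts d)
        (transitive r d d′ eq))

  rotation-cong : ∀ {ρ σ} → ρ ≗ σ → Rotation ρ → Rotation σ
  rotation-cong eq r = record
    { injective  = λ {x} {y} e → injective r (trans (eq x) (trans e (sym (eq y))))
    ; at-vertex  = λ d → trans (cong base (sym (eq d))) (at-vertex r d)
    ; transitive = λ d d′ e → reach-cong eq (transitive r d d′ e)
    }

  ∈-allVecs : {xs : List A} → (∀ x → x ∈ xs) → ∀ {n} (v : Vec A n) → v ∈ allVecs xs n
  ∈-allVecs all []ᵛ      = here refl
  ∈-allVecs all (x ∷ᵛ v) = Mem.∈-cartesianProductWith⁺ _∷ᵛ_ (all x) (∈-allVecs all v)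

  table : (Dart → Dart) → Table
  table ρ = Vec.tabulate λ e → Vec.tabulate λ s → ρ (e , s)

  apply-table : ∀ ρ → ρ ≗ apply (table ρ)
  apply-table ρ (e , s) = sym (trans (cong (λ v → lookup v s)
      (Vec.lookup∘tabulate (λ e → Vec.tabulate λ s → ρ (e , s)) e)) (Vec.lookup∘tabulate (λ s → ρ (e , s)) s))

  faceMap : (Dart → Dart) → Dart → Dart
  faceMap ρ d = ρ (flip d)

  flip-injective : Injective _≡_ _≡_ flip
  flip-injective {e , s} {e′ , s′} eq = cong₂ _,_ (cong proj₁ eq)
    (trans (sym (Fin.opposite-involutive s)) (trans (cong (Data.Fin.opposite ∘ proj₂) eq) (Fin.opposite-involutive s′)))

  faceMap-injective : ∀ {ρ} → Injective _≡_ _≡_ ρ → Injective _≡_ _≡_ (faceMap ρ)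
  faceMap-injective inj = flip-injective ∘ inj

  disagreements : (σ ρ : Dart → Dart) → List Dart
  disagreements σ ρ = filter (λ d → ¬? (ρ d ≟ᵈ σ d)) darts

  filter-< : {P Q : A → Set} (P? : ∀ x → Dec (P x)) (Q? : ∀ x → Dec (Q x)) → (∀ {x} → Q x → P x) →
    ∀ {x xs} → x ∈ xs → P x → ¬ Q x → length (filter Q? xs) < length (filter P? xs)
  filter-< P? Q? Q⇒P {x} {_ ∷ ys} (here refl) p ¬q with P? x | Q? x
  ... | no ¬p | _     = contradiction p ¬p
  ... | yes _ | yes q = contradiction q ¬q
  ... | yes _ | no _  = s≤s (filter-≤ ys)
    where
    filter-≤ : ∀ xs → length (filter Q? xs) ≤ length (filter P? xs)
    filter-≤ []       = z≤n
    filter-≤ (x ∷ xs) with P? x | Q? x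
    ... | yes _ | yes _ = s≤s (filter-≤ xs)
    ... | yes _ | no _  = ℕ.m≤n⇒m≤1+n (filter-≤ xs)
    ... | no ¬p | yes q = contradiction (Q⇒P q) ¬p
    ... | no _  | no _  = filter-≤ xs
  filter-< P? Q? Q⇒P {xs = y ∷ ys} (there x∈xs) p ¬q with P? y | Q? y | filter-< P? Q? Q⇒P {xs = ys} x∈xs p ¬q
  ... | yes _ | yes _ | lt = s≤s lt
  ... | yes _ | no _  | lt = ℕ.m<n⇒m<1+n lt
  ... | no ¬p | yes q | _  = contradiction (Q⇒P q) ¬p
  ... | no _  | no _  | lt = lt

  module _ {σ f : Dart → Dart} (σ-inj : Injective _≡_ _≡_ σ) (f-inj : Injective _≡_ _≡_ f) {x : Dart}
      (fx≢σx : f x ≢ σ x) where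

    corrected : Dart → Dart
    corrected d = swap (f x) (σ x) (f d)

    correction : corrected x ≡ σ x
    correction = swap-left (f x) (σ x)

    -- By injectivity only `x` is sent to `f x` by `f` and to `σ x` by `σ`, so the transposition
    -- does not affect darts where the two agree.
    corrected-keeps : ∀ {d} → f d ≡ σ d → corrected d ≡ σ d
    corrected-keeps {d} eq = trans (swap-other (λ fd≡fx → d≢x (f-inj fd≡fx))
        (λ fd≡σx → d≢x (σ-inj (trans (sym eq) fd≡σx)))) eq
      where
      d≢x : d ≢ x
      d≢x refl = fx≢σx eq

    corrected-closer : length (disagreements σ corrected) < length (disagreements σ f)
    corrected-closer = filter-< (λ d → ¬? (f d ≟ᵈ σ d)) (λ d → ¬? (corrected d ≟ᵈ σ d))
        (λ ¬c fd≡σd → ¬c (corrected-keeps fd≡σd)) (∈-darts x) fx≢σx (λ ¬c → ¬c correction)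

    corrected-injective : Injective _≡_ _≡_ corrected
    corrected-injective = f-inj ∘ swap-injective (f x) (σ x)

    -- `faceMap` composes with `flip` on the other side, so the same transposition multiplies the
    -- face permutation.
    corrected-faces : count (faceMap corrected) ≡ suc (count (faceMap f)) ⊎ count (faceMap f) ≡ suc
        (count (faceMap corrected))
    corrected-faces with reach? (faceMap-injective f-inj) (f x) (σ x)
    ... | yes r = inj₁ (count-split (faceMap-injective f-inj) fx≢σx r)
    ... | no ¬r = inj₂ (count-join (faceMap-injective f-inj) ¬r)

  leaving : ∀ {σ : Dart → Dart} {P : Dart → Set} (P? : ∀ d → Dec (P d)) k {d} → P d → ¬ P (iter σ k d) → ∃[ t ] P t
      × ¬ P (σ t)
  leaving         P? zero    p ¬p = contradiction p ¬p
  leaving {σ = σ} P? (suc k) {d} p ¬p with P? (σ d)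
  ... | yes p′ = leaving P? k p′ ¬p
  ... | no ¬p′ = d , p , ¬p′

  -- Two transpositions bring ρ closer to σ: the first one splits the cycle of
  -- ρ at the vertex of x, and the second one joins the two parts again.
  approach : ∀ {σ ρ} → Rotation σ → Rotation ρ → ∀ {x} → ρ x ≢ σ x →
    ∃[ ρ′ ] Rotation ρ′ × length (disagreements σ ρ′) < length (disagreements σ ρ) ×
      (count (faceMap ρ′) ≡ 2 + count (faceMap ρ) ⊎ count (faceMap ρ′) ≡ count (faceMap ρ) ⊎ count (faceMap ρ) ≡ 2 +
          count (faceMap ρ′))
  approach {σ} {ρ} rσ rρ {x} ρx≢σx = build (leaving (reach? f-inj z) (proj₁ z⇒y) reach-refl
      (subst (λ d → ¬ Reach f z d) (sym (proj₂ z⇒y)) (¬y~z ∘ reach-sym f-inj)))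
    where
    y z : Dart
    y = ρ x
    z = σ x
    f : Dart → Dart
    f = corrected (injective rσ) (injective rρ) ρx≢σx
    f-inj : Injective _≡_ _≡_ f
    f-inj = corrected-injective (injective rσ) (injective rρ) ρx≢σx
    base-y : base y ≡ base x
    base-y = at-vertex rρ x
    base-z : base z ≡ base x
    base-z = at-vertex rσ x
    y~z : Reach ρ y z
    y~z = transitive rρ y z (trans base-y (sym base-z))
    ¬y~z : ¬ Reach f y z
    ¬y~z = separates (injective rρ) ρx≢σx y~z
    z⇒y : Reach σ z y
    z⇒y = transitive rσ z y (trans base-z (sym base-y))
    f-vertex : ∀ d → base (f d) ≡ base d
    f-vertex d with swapCase y z (ρ d)
    ... | left  eq eq′  = trans (cong base eq′) (trans (trans base-z (sym base-y))
        (trans (cong base (sym eq)) (at-vertex rρ d)))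
    ... | right eq eq′  = trans (cong base eq′) (trans (trans base-y (sym base-z))
        (trans (cong base (sym eq)) (at-vertex rρ d)))
    ... | other _ _ eq′ = trans (cong base eq′) (at-vertex rρ d)
    -- `σ` runs through all darts at the vertex, so on its way from `z` to `y` it must leave the
    -- `f`-orbit of `z`. The second correction is made at the dart `t` where this happens.
    build : ∃[ t ] Reach f z t × ¬ Reach f z (σ t) → _
    build (t , z~t , ¬z~σt) = g , record { injective = g-inj ; at-vertex = g-vertex ; transitive = g-transitive }
        , ℕ.<-trans (corrected-closer (injective rσ) f-inj ft≢σt) (corrected-closer (injective rσ) (injective rρ) ρx≢σx)
        , faces-change (corrected-faces (injective rσ) (injective rρ) ρx≢σx)
            (corrected-faces (injective rσ) f-inj ft≢σt)
      where
      z~ft : Reach f z (f t)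
      z~ft = reach-trans z~t (reach-step refl)
      ft≢σt : f t ≢ σ t
      ft≢σt eq = ¬z~σt (subst (Reach f z) eq z~ft)
      ¬ft~σt : ¬ Reach f (f t) (σ t)
      ¬ft~σt r = ¬z~σt (reach-trans z~ft r)
      g : Dart → Dart
      g = corrected (injective rσ) f-inj ft≢σt
      g-inj : Injective _≡_ _≡_ g
      g-inj = corrected-injective (injective rσ) f-inj ft≢σt
      base-t : base (f t) ≡ base (σ t)
      base-t = trans (f-vertex t) (sym (at-vertex rσ t))
      g-vertex : ∀ d → base (g d) ≡ base d
      g-vertex d with swapCase (f t) (σ t) (f d)
      ... | left  eq eq′  = trans (cong base eq′) (trans (sym base-t) (trans (cong base (sym eq)) (f-vertex d)))
      ... | right eq eq′  = trans (cong base eq′) (trans base-t (trans (cong base (sym eq)) (f-vertex d)))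
      ... | other _ _ eq′ = trans (cong base eq′) (f-vertex d)
      coarse : ∀ {u v} → Reach f u v → Reach g u v
      coarse = coarsens f-inj ¬ft~σt
      base-reach : ∀ {u v} → Reach f u v → base u ≡ base v
      base-reach {u} r = reach-inv {P = λ v → base u ≡ base v} (λ eq → trans eq (sym (f-vertex _))) r refl
      -- `σ t` lies at the vertex of `x`, whose darts `f` divides between the orbits of `y` and `z`,
      -- and it is not in the latter.
      y~σt : Reach f y (σ t)
      y~σt with touched-or-kept (injective rρ) {y} {z}
          (transitive rρ z (σ t) (trans (base-reach z~t) (sym (at-vertex rσ t))))
      ... | inj₁ (inj₁ r) = r
      ... | inj₁ (inj₂ r) = contradiction r ¬z~σt
      ... | inj₂ r        = contradiction r ¬z~σt
      z~y : Reach g z y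
      z~y = reach-trans (coarse z~ft) (reach-trans (joins f-inj ¬ft~σt) (coarse (reach-sym f-inj y~σt)))
      from-z : ∀ {u v} → Reach f y v ⊎ Reach f z v → Reach g z v
      from-z (inj₁ r) = reach-trans z~y (coarse r)
      from-z (inj₂ r) = coarse r
      -- Two darts at one vertex are either still connected by `f` or both lie in the orbits of `y`
      -- and `z`, which `g` has joined.
      g-transitive : ∀ u v → base u ≡ base v → Reach g u v
      g-transitive u v eq with touched-or-kept (injective rρ) {y} {z} (transitive rρ u v eq) | touched-or-kept
          (injective rρ) {y} {z} (transitive rρ v u (sym eq))
      ... | inj₂ r | _      = coarse r
      ... | inj₁ _ | inj₂ r = reach-sym g-inj (coarse r)
      ... | inj₁ v∈ | inj₁ u∈ = reach-trans (reach-sym g-inj (from-z {v} u∈)) (from-z {u} v∈)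
      faces-change : ∀ {a b c} → b ≡ suc a ⊎ a ≡ suc b → c ≡ suc b ⊎ b ≡ suc c → c ≡ 2 + a ⊎ c ≡ a ⊎ a ≡ 2 + c
      faces-change (inj₁ refl) (inj₁ refl) = inj₁ refl
      faces-change (inj₁ refl) (inj₂ refl) = inj₂ (inj₁ refl)
      faces-change (inj₂ refl) (inj₁ refl) = inj₂ (inj₁ refl)
      faces-change (inj₂ refl) (inj₂ refl) = inj₂ (inj₂ refl)

  -- Euler's formula without subtraction: the genus of `ρ` lies `k` below `g`.
  Excess : ℕ → (Dart → Dart) → ℕ → Set
  Excess g ρ k = order + count (faceMap ρ) + 2 * g ≡ size + 2 + 2 * k

  -- The genus changes by at most 1 in each step of the approach to σ, so that
  -- every genus between those of ρ and σ occurs on the way.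
  intermediate : ∀ {σ g} → Rotation σ → order + count (faceMap σ) + 2 * g < size + 2 →
    ∀ n k {ρ} → Rotation ρ → length (disagreements σ ρ) < n → Excess g ρ k → ∃[ ρ′ ] Rotation ρ′ × Excess g ρ′ 0
  intermediate         rσ less n       zero    {ρ} rρ close excess = ρ , rρ , excess
  intermediate {σ} {g} rσ less (suc n) (suc k) {ρ} rρ close excess = decide (Any.any? (λ d → ¬? (ρ d ≟ᵈ σ d)) darts)
    where
    open +-*-Solver
    raise : ∀ o c g → o + (2 + c) + 2 * g ≡ 2 + (o + c + 2 * g)
    raise = solve 3 (λ o c g → o :+ (con 2 :+ c) :+ con 2 :* g := con 2 :+ (o :+ c :+ con 2 :* g)) refl
    raise′ : ∀ s k → s + 2 + 2 * suc k ≡ 2 + (s + 2 + 2 * k)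
    raise′ = solve 2 (λ s k → s :+ con 2 :+ con 2 :* (con 1 :+ k) := con 2 :+ (s :+ con 2 :+ con 2 :* k)) refl
    Found : Set
    Found = ∃[ ρ′ ] Rotation ρ′ × Excess g ρ′ 0
    closer : ∀ {x} → ρ x ≢ σ x → Found
    closer ρx≢σx = let ρ′ , rρ′ , lt , change = approach rσ rρ ρx≢σx in continue ρ′ rρ′ lt change
      where
      c = count (faceMap ρ)
      continue : ∀ ρ′ → Rotation ρ′ → length (disagreements σ ρ′) < length (disagreements σ ρ) → let c′ = count (faceMap ρ′) in
        c′ ≡ 2 + c ⊎ c′ ≡ c ⊎ c ≡ 2 + c′ → Found
      continue ρ′ rρ′ lt change = by change
        where
        c′ = count (faceMap ρ′)
        next-step : ∀ k′ → Excess g ρ′ k′ → Found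
        next-step k′ = intermediate {σ} {g} rσ less n k′ rρ′ (ℕ.<-≤-trans lt (ℕ.≤-pred close))
        by : c′ ≡ 2 + c ⊎ c′ ≡ c ⊎ c ≡ 2 + c′ → Found
        by (inj₁ up)          = next-step (2 + k) (trans (cong (λ c → order + c + 2 * g) up)
            (trans (raise order c g) (trans (cong (2 +_) excess) (sym (raise′ size (suc k))))))
        by (inj₂ (inj₁ same)) = next-step (suc k) (trans (cong (λ c → order + c + 2 * g) same) excess)
        by (inj₂ (inj₂ down)) = next-step k (ℕ.+-cancelˡ-≡ 2 _ _
            (trans (sym (raise order c′ g)) (trans (cong (λ c → order + c + 2 * g) (sym down))
            (trans excess (raise′ size k)))))
    decide : Dec (Any (λ d → ρ d ≢ σ d) darts) → Found
    decide (yes some) = closer (proj₂ (proj₂ (find some)))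
    -- Without disagreements `ρ` is `σ`, whose genus lies above `g`.
    decide (no none)  = contradiction (ℕ.≤-<-trans
        (ℕ.≤-trans (ℕ.m≤m+n (size + 2) (2 * suc k)) (ℕ.≤-reflexive
        (trans (sym excess) (cong (λ c → order + c + 2 * g) same)))) less) (ℕ.<-irrefl refl)
      where
      agree : ρ ≗ σ
      agree d with ρ d ≟ᵈ σ d
      ... | yes eq = eq
      ... | no ≢   = contradiction (lose (∈-darts d) ≢) none
      same : count (faceMap ρ) ≡ count (faceMap σ)
      same = count-cong (faceMap-injective (injective rρ)) (faceMap-injective (injective rσ)) (agree ∘ flip)

  embedding⁻ : ∀ {g} → 0 < genusPoly g → ∃[ ρ ] Rotation ρ × order + count (faceMap ρ) + 2 * g ≡ size + 2
  embedding⁻ {g} 0<p = first (embeddings g) (Allₚ.all-filter (λ ρ → isRotation? ρ ×-dec hasGenus? g ρ) tables) 0<p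
    where
    first : ∀ ts → All (λ ρ → IsRotation ρ × HasGenus g ρ) ts → 0 < length ts → ∃[ ρ ] Rotation ρ × order + count
        (faceMap ρ) + 2 * g ≡ size + 2
    first (t ∷ _) ((rot , genus) ∷ _) _ = apply t , isRotation⇒rotation t rot , genus

  embedding⁺ : ∀ {g ρ} → Rotation ρ → order + count (faceMap ρ) + 2 * g ≡ size + 2 → 0 < genusPoly g
  embedding⁺ {g} {ρ} r genus = Mem.∈-length (Mem.∈-filter⁺ (λ ρ → isRotation? ρ ×-dec hasGenus? g ρ)
      (∈-allVecs (∈-allVecs ∈-darts) (table ρ)) (rotation⇒isRotation (table ρ) r′ , genus′))
    where
    r′ : Rotation (apply (table ρ))
    r′ = rotation-cong (apply-table ρ) r
    genus′ : HasGenus g (table ρ)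
    genus′ = trans (cong (λ c → order + c + 2 * g)
        (sym (count-cong (faceMap-injective (injective r)) (faceMap-injective (injective r′))
        (apply-table ρ ∘ flip)))) genus

  genusPoly-no-gap : ∀ {i j k} → i < j → j < k → 0 < genusPoly i → 0 < genusPoly k → 0 < genusPoly j
  genusPoly-no-gap {i} {j} {k} i<j j<k pᵢ pₖ =
    let ρ , rρ , genusᵢ = embedding⁻ {i} pᵢ
        σ , rσ , genusₖ = embedding⁻ {k} pₖ
        τ , rτ , excess = intermediate {σ} {j} rσ
          (subst (order + count (faceMap σ) + 2 * j <_) genusₖ
              (ℕ.+-monoʳ-< (order + count (faceMap σ)) (ℕ.*-monoʳ-< 2 j<k)))
          (suc (length (disagreements σ ρ))) (j ∸ i) rρ ℕ.≤-refl
          (trans (cong (λ j → order + count (faceMap ρ) + 2 * j) (sym (ℕ.m+[n∸m]≡n (ℕ.<⇒≤ i<j))))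
            (trans (distribute (order + count (faceMap ρ)) i (j ∸ i)) (cong (_+ 2 * (j ∸ i)) genusᵢ)))
    in embedding⁺ {j} rτ (trans excess (ℕ.+-identityʳ (size + 2)))
    where
    open +-*-Solver
    distribute : ∀ c i d → c + 2 * (i + d) ≡ c + 2 * i + 2 * d
    distribute = solve 3 (λ c i d → c :+ con 2 :* (i :+ d) := c :+ con 2 :* i :+ con 2 :* d) refl

  genusPoly-vanishes : ∀ g → 3 + size ≤ g → genusPoly g ≡ 0
  genusPoly-vanishes g big with ℕ.m≤n⇒m<n∨m≡n (z≤n {genusPoly g})
  ... | inj₂ eq  = sym eq
  ... | inj₁ 0<p = let ρ , _ , genus = embedding⁻ {g} 0<p in
    contradiction (ℕ.≤-trans big (ℕ.≤-trans (ℕ.m≤m+n g (g + 0))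
        (ℕ.≤-trans (ℕ.m≤n+m (2 * g) (order + count (faceMap ρ))) (ℕ.≤-reflexive (trans genus (ℕ.+-comm size 2))))))
      (ℕ.<-irrefl refl)

-- Transfer from the factors to the genus polynomial of the product

strong-cong : ∀ {p q} → p ≗ q → StronglyLogConcave q → StronglyLogConcave p
strong-cong eq strong {i} {j} i≤j rewrite eq i | eq j | eq (suc i) | eq (suc j) = strong i≤j

⊛-preserves : ∀ (G H : Graph) {q : Poly} → StronglyLogConcave q → Graph.genusPoly H ≗ Graph.genusPoly G ⊛ q →
  (LogConcave (Graph.genusPoly G) → LogConcave (Graph.genusPoly H)) ×
      (Unimodal (Graph.genusPoly G) → Unimodal (Graph.genusPoly H))
⊛-preserves G H {q} strong eq = log-concave , unimodal
  where
  p = Graph.genusPoly G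
  log-concave : LogConcave p → LogConcave (Graph.genusPoly H)
  log-concave lc i rewrite eq i | eq (1 + i) | eq (2 + i) = ⊛-log-concave p q
      (log-concave⇒strong lc (genusPoly-no-gap G)) strong i
  unimodal : Unimodal p → Unimodal (Graph.genusPoly H)
  -- The convolution vanishes for large indices because it is the genus polynomial of `H`.
  unimodal u with m , up , down ← ⊛-unimodal p q u strong (3 + Graph.size H)
      (λ k le → trans (sym (eq k)) (genusPoly-vanishes H k le)) =
      m , (λ i i<m → subst₂ _≤_ (sym (eq i)) (sym (eq (suc i))) (up i i<m))
        , (λ i m≤i → subst₂ _≤_ (sym (eq (suc i))) (sym (eq i)) (down i m≤i))

open Graph using (Edge; Connected; genusPoly)

theorem4p4 : (G₀ : Graph) → Connected G₀ →
    (e₀ e₁ : Edge G₀) (n : ℕ) → n ≥ 1 →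
    (Gₙ : Graph) → (Gₙ ≡ ladder G₀ e₀ e₁ n ⊎ Gₙ ≡ cross G₀ e₀ e₁ n) →
    (genusPoly Gₙ ≗ genusPoly G₀ ⊛ surfacePoly n S₁ ⊎ genusPoly Gₙ ≗ genusPoly G₀ ⊛ surfacePoly n S₆) →
    (LogConcave (genusPoly G₀) → LogConcave (genusPoly Gₙ)) × (Unimodal (genusPoly G₀) → Unimodal (genusPoly Gₙ))
theorem4p4 G₀ _ _ _ (suc n) _ Gₙ _ (inj₁ eq) = ⊛-preserves G₀ Gₙ
    (strong-cong (surfacePoly-S₁ n) (pieces-strong joined (suc n))) eq
theorem4p4 G₀ _ _ _ n _ Gₙ _ (inj₂ eq) = ⊛-preserves G₀ Gₙ (strong-cong (surfacePoly-S₆ n) (pieces-strong apart n)) eq
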